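{- Every finite $2$-connected graph $G$ has the strong $\mathcal{F}_3$ property: for any three distinct vertices $x_1, x_2, x_3$ of $G$ and any given $i \in \{1,2\}$, there is a hamiltonian path in $G^2$ from $x_1$ to $x_2$ which contains two distinct edges $x_3z_3$ and $x_iz_i$ of $G$ (for some $z_3, z_i \in V(G)$).
   Context: All graphs are finite and simple. The square $G^2$ of $G$ is the graph on $V(G)$ in which two distinct vertices are adjacent iff their distance in $G$ is at most $2$; thus $E(G)\subseteq E(G^2)$. -}

module Defs where

open import Data.Nat using (ℕ; _≤_)
open import Data.Fin using (Fin)
open import Data.List using (List; []; _∷_; _++_; head; last)
open import Data.List.Membership.Propositional using (_∈_)
open import Data.List.Relation.Unary.Unique.Propositional using (Unique)
open import Data.List.Relation.Unary.Linked using (Linked)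
open import Data.Maybe using (just)
open import Data.Product using (Σ; _×_; ∃; ∃₂)
open import Data.Sum using (_⊎_)
open import Data.Unit using (⊤)
open import Relation.Nullary using (¬_)
open import Relation.Binary.PropositionalEquality using (_≡_; _≢_)

record Graph (n : ℕ) : Set₁ where
  field
    Adj    : Fin n → Fin n → Set
    sym    : ∀ {u v} → Adj u v → Adj v u
    irrefl : ∀ {u} → ¬ Adj u u
open Graph public

module _ {n : ℕ} (G : Graph n) where

  data ConnIn (P : Fin n → Set) : Fin n → Fin n → Set where
    here : ∀ {u} → P u → ConnIn P u u
    step : ∀ {u v w} → P u → Adj G u v → ConnIn P v w → ConnIn P u w

  Connected : Set
  Connected = ∀ u w → ConnIn (λ _ → ⊤) u w

  TwoConnected : Set
  TwoConnected = (3 ≤ n) × Connected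
    × (∀ v u w → u ≢ v → w ≢ v → ConnIn (λ x → x ≢ v) u w)

  Sq : Graph n
  Sq = record
    { Adj = λ u v → (u ≢ v) × (Adj G u v ⊎ ∃ λ w → Adj G u w × Adj G w v)
    ; sym = λ { (d , inj₁ a) → (λ e → d (symm e)) , inj₁ (sym G a)
              ; (d , inj₂ (w , a , b)) → (λ e → d (symm e)) , inj₂ (w , sym G b , sym G a) }
    ; irrefl = λ { (d , _) → d refl }
    }
    where
      open import Data.Product using (_,_)
      open import Data.Sum using (inj₁; inj₂)
      open import Relation.Binary.PropositionalEquality using (refl) renaming (sym to symm)

  HamPath : Fin n → Fin n → List (Fin n) → Set
  HamPath x y p = Unique p × (∀ v → v ∈ p) × Linked (Adj G) p
    × head p ≡ just x × last p ≡ just y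

PathEdge : {A : Set} → List A → A → A → Set
PathEdge p u v = (∃₂ λ as bs → p ≡ as ++ u ∷ v ∷ bs) ⊎ (∃₂ λ as bs → p ≡ as ++ v ∷ u ∷ bs)

SameEdge : {A : Set} → A → A → A → A → Set
SameEdge a b c d = (a ≡ c × b ≡ d) ⊎ (a ≡ d × b ≡ c)

{-# OPTIONS --safe #-}
module Submission where

open import Defs
import Algebra.Solver.CommutativeMonoid
open import Data.Empty using (⊥; ⊥-elim)
open import Data.Fin using (Fin)
import Data.Fin.Properties as Fin
open import Data.List using (List; []; _∷_; _++_; [_]; allFin; concat; concatMap; head; last; length; map; reverse)
open import Data.List.Membership.Propositional using (_∈_; _∉_; lose)
open import Data.List.Membership.Propositional.Properties using (∈-++⁺ˡ; ∈-++⁺ʳ; ∈-++⁻; ∈-allFin; ∈-length)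
import Data.List.Properties as List
open import Data.List.Properties using (unfold-reverse; ++-assoc; ++-identityʳ; length-++)
open import Data.List.Relation.Binary.Permutation.Propositional using (_↭_; refl; prep; swap; trans; ↭-sym; ↭-reflexive)
open import Data.List.Relation.Binary.Permutation.Propositional.Properties using (++⁺; ++⁺ˡ; ++⁺ʳ; shift; shifts; ↭-reverse; ++-comm; ++-commutativeMonoid; Any-resp-↭; ↭-length; All-resp-↭; ∈-resp-↭; drop-∷)
open import Data.List.Relation.Unary.All as All using (All; []; _∷_)
import Data.List.Relation.Unary.All.Properties as All
open import Data.List.Relation.Unary.AllPairs using ([]; _∷_)
open import Data.List.Relation.Unary.Any as Any using (Any; here; there)
import Data.List.Relation.Unary.Any.Properties as Any
open import Data.List.Relation.Unary.Linked using (Linked; []; [-]; _∷_)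
open import Data.List.Relation.Unary.Unique.Propositional using (Unique)
open import Data.List.Relation.Unary.Unique.Propositional.Properties using (allFin⁺)
open import Data.Maybe using (just)
open import Data.Nat using (ℕ; zero; suc; _≤_; _<_; z≤n; s≤s)
import Data.Nat.Properties as ℕ
open import Data.Product using (Σ; ∃; ∃₂; _×_; _,_; proj₁; proj₂)
open import Data.Product.Properties using (≡-dec)
import Data.Sum as Sum
open import Data.Sum using (_⊎_; inj₁; inj₂)
open import Function using (_∘_; id)
open import Relation.Binary.Definitions using (DecidableEquality; Decidable)
open import Relation.Binary.PropositionalEquality as ≡ using (_≡_; _≢_; cong; subst)
open import Relation.Nullary using (¬_; Dec; yes; no)
open import Relation.Nullary.Decidable using (_×-dec_; _⊎-dec_; ¬?)

-- Induction on the number of vertices, over all symmetric relations E and all vertex sets A.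
--
-- Sweeping.  Let Q = c₁ … cₘ be a path of G and suppose that the vertices outside Q are partitioned into
-- "strands": paths of G² whose ends have neighbours on Q.  Two of the strands end in the prescribed ends x, y.
-- Going along Q one can always splice everything into a single path: ends attached to the same cᵢ are pairwise
-- adjacent in G², and among any three of them two can be joined without closing a cycle and without joining
-- x to y too early; what is left over is carried to cᵢ₊₁, either through cᵢ or by jumping over it.
--
-- Strands.  A component C of G − Q, with Q contracted to one vertex, is 2-connected and smaller.  The induction
-- hypothesis gives a hamiltonian cycle of its square using two edges of G at the contracted vertex and one more at
-- a prescribed vertex; cut at the jumps over the contracted vertex, it falls into strands.
--
-- The start.  The first edge must lie in G and x₂ must come last.  Either G − x₁ is a chain of blocks, along which
-- the induction hypothesis is concatenated, or it has an end block Z ∪ {w} avoiding x₂ and x₃ (apart from w).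
-- Then Q runs from x₂ to w, and Z serves as a strand from x₁ to w, or as one with both ends at w if the strands
-- attached to x₁ have to be started from x₁ for reasons of parity.
--
-- The vertex x₃.  If x₃ has a neighbour off Q and x₁, its component is large enough for the induction hypothesis
-- to provide the edge at x₃.  Otherwise G − x₃ is a block or a chain of blocks from x₁ to x₂, and x₃ is inserted
-- next to a neighbour; only N(x₃) = {x₁, x₂} needs another sweep, in which x₃ is put in front of x₂.

-- Consecutive pairs and paths in lists.

module ↭-Solver {V : Set} = Algebra.Solver.CommutativeMonoid (++-commutativeMonoid {A = V})

data Edge {V : Set} (u v : V) : List V → Set where
  fwd  : ∀ {l} → Edge u v (u ∷ v ∷ l)
  bwd  : ∀ {l} → Edge u v (v ∷ u ∷ l)
  next : ∀ {x l} → Edge u v l → Edge u v (x ∷ l)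

module _ {V : Set} {u v : V} where

  edge-++ˡ : ∀ {l} m → Edge u v l → Edge u v (l ++ m)
  edge-++ˡ m fwd      = fwd
  edge-++ˡ m bwd      = bwd
  edge-++ˡ m (next e) = next (edge-++ˡ m e)

  edge-++ʳ : ∀ m {l} → Edge u v l → Edge u v (m ++ l)
  edge-++ʳ []      e = e
  edge-++ʳ (x ∷ m) e = next (edge-++ʳ m e)

  edge-reverse : ∀ {l} → Edge u v l → Edge u v (reverse l)
  edge-reverse (fwd {l}) rewrite unfold-reverse u (v ∷ l) | unfold-reverse v l
    | ++-assoc (reverse l) (v ∷ []) (u ∷ []) = edge-++ʳ (reverse l) bwd
  edge-reverse (bwd {l}) rewrite unfold-reverse v (u ∷ l) | unfold-reverse u l
    | ++-assoc (reverse l) (u ∷ []) (v ∷ []) = edge-++ʳ (reverse l) fwd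
  edge-reverse (next {x} {l} e) rewrite unfold-reverse x l = edge-++ˡ (x ∷ []) (edge-reverse e)

data Path {V : Set} (R : V → V → Set) : V → V → List V → Set where
  end : ∀ a → Path R a a (a ∷ [])
  _∷_ : ∀ {a b c l} → R a b → Path R b c l → Path R a c (a ∷ l)

module _ {V : Set} {R : V → V → Set} where

  path-++ : ∀ {a b c d l m} → Path R a b l → R b c → Path R c d m → Path R a d (l ++ m)
  path-++ (end a) r q = r ∷ q
  path-++ (s ∷ p) r q = s ∷ path-++ p r q

  path-glue : ∀ {a b c l m} → Path R a b l → Path R b c (b ∷ m) → Path R a c (l ++ m)
  path-glue (end a) q = q
  path-glue (s ∷ p) q = s ∷ path-glue p q

  path-reverse : (∀ {u v} → R u v → R v u) → ∀ {a b l} → Path R a b l → Path R b a (reverse l)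
  path-reverse R-sym (end a) = end a
  path-reverse R-sym (_∷_ {a} {l = l} s p) rewrite unfold-reverse a l =
    path-++ (path-reverse R-sym p) (R-sym s) (end a)

concat-↭ : ∀ {V : Set} {S T : List (List V)} → S ↭ T → concat S ↭ concat T
concat-↭ refl          = refl
concat-↭ (prep s p)    = ++⁺ˡ s (concat-↭ p)
concat-↭ (swap s t p) = trans (shifts s t) (++⁺ˡ t (++⁺ˡ s (concat-↭ p)))
concat-↭ (trans p q)   = trans (concat-↭ p) (concat-↭ q)

-- Sweeping strands along a path.

module Sweep {V : Set} (E : V → V → Set) (E-sym : ∀ {u v} → E u v → E v u) where

  N² : V → V → Set
  N² u v = E u v ⊎ ∃ λ m → E u m × E m v

  N²-sym : ∀ {u v} → N² u v → N² v u
  N²-sym (inj₁ e)           = inj₁ (E-sym e)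
  N²-sym (inj₂ (m , e , f)) = inj₂ (m , E-sym f , E-sym e)

  via : ∀ {u v} c → E u c → E v c → N² u v
  via c e f = inj₂ (c , e , E-sym f)

  infix 4 _⊑_
  -- The direction in which the sweep rewrites: strands are permuted, reversed and joined, so
  -- consecutive pairs are only gained and a link of `T` serves for `S`.
  _⊑_ : List (List V) → List (List V) → Set
  S ⊑ T = concat T ↭ concat S × (∀ {u v} → Any (Edge u v) S → Any (Edge u v) T)

  ⊑-trans : ∀ {S T U} → S ⊑ T → T ⊑ U → S ⊑ U
  ⊑-trans (π , f) (ρ , g) = trans ρ π , λ a → g (f a)

  ⊑-perm : ∀ {S T} → S ↭ T → S ⊑ T
  ⊑-perm σ = concat-↭ (↭-sym σ) , Any-resp-↭ σ

  ⊑-cons : ∀ {S T} s → S ⊑ T → s ∷ S ⊑ s ∷ T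
  ⊑-cons s (π , f) = ++⁺ˡ s π , λ { (here a) → here a ; (there a) → there (f a) }

  ⊑-++ : ∀ {F G} S → F ⊑ G → S ++ F ⊑ S ++ G
  ⊑-++ []      r = r
  ⊑-++ (s ∷ S) r = ⊑-cons s (⊑-++ S r)

  ⊑-reverse : ∀ {s S} → s ∷ S ⊑ reverse s ∷ S
  ⊑-reverse {s} {S} = ++⁺ʳ (concat S) (↭-reverse s) , λ { (here a) → here (edge-reverse a) ; (there a) → there a }

  ⊑-join : ∀ {s t S} → s ∷ t ∷ S ⊑ (s ++ t) ∷ S
  ⊑-join {s} {t} {S} = ↭-reflexive (++-assoc s t (concat S)) ,
    λ { (here a) → here (edge-++ˡ t a) ; (there (here a)) → here (edge-++ʳ s a) ; (there (there a)) → there a }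

  -- Pairs inside the strands are kept, so that an edge of the graph placed in a strand beforehand
  -- survives in the final path.
  Linkable : V → V → List (List V) → Set
  Linkable x y S = ∃ λ P → Path N² x y P × P ↭ concat S × (∀ {u v} → Any (Edge u v) S → Edge u v P)

  module _ {x y : V} where

    link-⊑ : ∀ {S T} → S ⊑ T → Linkable x y T → Linkable x y S
    link-⊑ (ρ , f) (P , p , π , e) = P , p , trans π ρ , λ a → e (f a)

    link-perm : ∀ {S T} → S ↭ T → Linkable x y S → Linkable x y T
    link-perm σ = link-⊑ (⊑-perm (↭-sym σ))

    link-join : ∀ {s t S} → Linkable x y ((s ++ t) ∷ S) → Linkable x y (s ∷ t ∷ S)
    link-join = link-⊑ ⊑-join

    link-reverse : ∀ {s S} → Linkable x y (reverse s ∷ S) → Linkable x y (s ∷ S)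
    link-reverse = link-⊑ ⊑-reverse

  lift-link : ∀ {x y F G} → F ⊑ G → ∀ S → Linkable x y (S ++ G) → Linkable x y (S ++ F)
  lift-link r S = link-⊑ (⊑-++ S r)

  link-swap : ∀ {x y S} → Linkable x y S → Linkable y x S
  link-swap (P , p , π , e) =
    reverse P , path-reverse N²-sym p , trans (↭-reverse P) π , λ a → edge-reverse (e a)

  -- X and Y are listed from their open ends to the prescribed ends x and y; the vertices of Q are still unused.
  conf : List V → List V → List (List V) → List V → List (List V)
  conf X Y F Q = X ∷ Y ∷ map [_] Q ++ F

  module _ {x y : V} where

    permF : ∀ {X Y F G} Q → F ↭ G → Linkable x y (conf X Y F Q) → Linkable x y (conf X Y G Q)
    permF {X} {Y} Q σ = link-perm (prep X (prep Y (++⁺ˡ (map (_∷ []) Q) σ)))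

    toFront : ∀ {X Y s F} Q → Linkable x y (s ∷ conf X Y F Q) → Linkable x y (conf X Y (s ∷ F) Q)
    toFront {X} {Y} {s} {F} Q = link-perm (trans (swap s X refl) (prep X (trans (swap s Y refl)
      (prep Y (↭-sym (shift s (map (_∷ []) Q) F))))))

    fromFront : ∀ {X Y s F} Q → Linkable x y (conf X Y (s ∷ F) Q) → Linkable x y (s ∷ conf X Y F Q)
    fromFront {X} {Y} {s} {F} Q = link-perm (↭-sym (trans (swap s X refl) (prep X (trans (swap s Y refl)
      (prep Y (↭-sym (shift s (map (_∷ []) Q) F)))))))

    revF : ∀ {X Y s F} Q → Linkable x y (conf X Y (reverse s ∷ F) Q) → Linkable x y (conf X Y (s ∷ F) Q)
    revF Q g = toFront Q (link-reverse (fromFront Q g))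

    joinX : ∀ {X Y s F} Q → Linkable x y (conf (s ++ X) Y F Q) → Linkable x y (conf X Y (s ∷ F) Q)
    joinX Q g = toFront Q (link-join g)

    joinX-rev : ∀ {X Y s F} Q → Linkable x y (conf (reverse s ++ X) Y F Q) → Linkable x y (conf X Y (s ∷ F) Q)
    joinX-rev Q g = revF Q (joinX Q g)

    joinF : ∀ {X Y s t F} Q → Linkable x y (conf X Y ((s ++ t) ∷ F) Q) →
            Linkable x y (conf X Y (s ∷ t ∷ F) Q)
    joinF {X} {Y} {s} {t} {F} Q g = toFront Q (back (link-join (fromFront Q g)))
      where
      back : Linkable x y (s ∷ t ∷ conf X Y F Q) → Linkable x y (s ∷ conf X Y (t ∷ F) Q)
      back = link-perm (prep s (trans (swap t X refl) (prep X (trans (swap t Y refl)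
        (prep Y (↭-sym (shift t (map (_∷ []) Q) F)))))))

    joinF-rev : ∀ {X Y s t F} Q → Linkable x y (conf X Y ((reverse t ++ s) ∷ F) Q) →
                Linkable x y (conf X Y (s ∷ t ∷ F) Q)
    joinF-rev {s = s} {t} Q g = permF Q (swap t s refl) (revF Q (joinF Q g))

    takeX : ∀ {X Y F} c Q → Linkable x y (conf (c ∷ X) Y F Q) → Linkable x y (conf X Y F (c ∷ Q))
    takeX {X} {Y} c Q g = link-perm (trans (swap (c ∷ []) X refl) (prep X (swap (c ∷ []) Y refl))) (link-join g)

    newF : ∀ {X Y F} c Q → Linkable x y (conf X Y ((c ∷ []) ∷ F) Q) → Linkable x y (conf X Y F (c ∷ Q))
    newF {X} {Y} c Q g =
      link-perm (trans (swap (c ∷ []) X refl) (prep X (swap (c ∷ []) Y refl))) (fromFront Q g)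

    takeF : ∀ {X Y s F} c Q → Linkable x y (conf X Y ((c ∷ s) ∷ F) Q) → Linkable x y (conf X Y (s ∷ F) (c ∷ Q))
    takeF c Q g = newF c Q (joinF Q g)

  swapXY : ∀ {x y X Y F} Q → Linkable y x (conf Y X F Q) → Linkable x y (conf X Y F Q)
  swapXY {X = X} {Y} Q g = link-swap (link-perm (swap Y X refl) g)

  At : List V → V → Set
  At Q e = Any (E e) Q

  -- An end left over at the previous vertex: it can only be continued to the first vertex of Q itself.
  Rear : List V → V → Set
  Rear []      e = ⊥
  Rear (c ∷ Q) e = N² e c

  Free : List V → List V → Set
  Free Q s = ∃₂ λ a b → Path N² a b s × At Q a × At Q b

  -- The states in which the sweep can reach the first vertex of `Q`. At most one end is a rear end;
  -- a rear end of `Y` is covered by exchanging `X` and `Y`. With `Q` empty no state can occur.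
  record Solve (Q : List V) : Set where
    field
      none  : ∀ {x y a b X Y F} → Path N² a x X → At Q a → Path N² b y Y → At Q b →
              All (Free Q) F → Linkable x y (conf X Y F Q)
      rearX : ∀ {x y a b X Y F} → Path N² a x X → Rear Q a → Path N² b y Y → At Q b →
              All (Free Q) F → Linkable x y (conf X Y F Q)
      rearF : ∀ {x y a b r q X Y s F} → Path N² a x X → At Q a → Path N² b y Y → At Q b →
              Path N² r q s → Rear Q r → At Q q →
              All (Free Q) F → Linkable x y (conf X Y (s ∷ F) Q)

  solve-[] : Solve []
  solve-[] = record { none = λ _ () ; rearX = λ _ () ; rearF = λ _ () }

  -- Pairing the strand ends at one vertex.

  module Locate (c : V) (Q : List V) where

    split : ∀ {e} → At (c ∷ Q) e → E e c ⊎ At Q e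
    split (here r)  = inj₁ r
    split (there a) = inj₂ a

    Touch : List V → Set
    Touch s = ∃₂ λ a b → Path N² a b s × E a c × At (c ∷ Q) b

    Found : List (List V) → Set
    Found F = ∃₂ λ s G → Touch s × All (Free (c ∷ Q)) G × length F ≡ suc (length G) ×
      F ⊑ s ∷ G

    -- A strand with only its second end at `c` is reversed, so that the end at `c` comes first.
    find : ∀ {F} → All (Free (c ∷ Q)) F → Found F ⊎ All (Free Q) F
    find [] = inj₂ []
    find {s ∷ F} ((a , b , p , at-a , at-b) ∷ fs) with split at-a | split at-b
    ... | inj₁ r | _      = inj₁ (s , F , (a , b , p , r , at-b) , fs , ≡.refl , ⊑-perm refl)
    ... | inj₂ _ | inj₁ r =
      inj₁ (reverse s , F , (b , a , path-reverse N²-sym p , r , at-a) , fs , ≡.refl , ⊑-reverse)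
    ... | inj₂ i | inj₂ j with find fs
    ...   | inj₂ gs = inj₂ ((a , b , p , i , j) ∷ gs)
    ...   | inj₁ (t , G , touch , gs , len , ref) =
      inj₁ (t , s ∷ G , touch , (a , b , p , at-a , at-b) ∷ gs , cong suc len ,
            ⊑-trans (⊑-cons s ref) (⊑-perm (swap s t refl)))

    fewer : ∀ {l m k} → l ≤ suc k → l ≡ suc m → m ≤ k
    fewer le eq with s≤s le′ ← subst (_≤ _) eq le = le′

    -- Two ends at `c` have distance at most two through `c`, which is jumped over and stays
    -- available.
    rev-join : ∀ {a b d f s t} → Path N² a b s → E a c → E d c → Path N² d f t → Path N² b f (reverse s ++ t)
    rev-join p e f q = path-++ (path-reverse N²-sym p) (via c e f) q

    Resolved : List (List V) → Set
    Resolved F = (∃ λ G → All (Free Q) G × F ⊑ G) ⊎ (∃₂ λ s G → Touch s × All (Free Q) G × F ⊑ s ∷ G)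

    -- Ends at `c` of different strands are joined in pairs. Each join lowers the number of strands,
    -- which `k` bounds, until at most one strand is left at `c`.
    resolve : ∀ k {F} → length F ≤ k → All (Free (c ∷ Q)) F → Resolved F
    resolve k len fs with find fs
    ... | inj₂ gs = inj₁ (_ , gs , ⊑-perm refl)
    resolve zero {[]} len fs | inj₁ (_ , _ , _ , _ , () , _)
    resolve (suc k) len fs | inj₁ (s , G , t@(_ , _ , p , e , at) , gs , eq , ref) with find gs
    ... | inj₂ hs = inj₂ (s , G , t , hs , ref)
    ... | inj₁ (s′ , H , (_ , _ , p′ , e′ , at′) , hs , eq′ , ref′)
      with resolve k (subst (_≤ k) eq′ (fewer len eq)) ((_ , _ , rev-join p′ e′ e p , at′ , at) ∷ hs)
         | ⊑-trans ref (⊑-trans (⊑-cons s ref′) (⊑-trans (⊑-perm (swap s s′ refl)) (⊑-trans ⊑-reverse ⊑-join)))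
    ...   | inj₁ (K , ks , r) | r′ = inj₁ (K , ks , ⊑-trans r′ r)
    ...   | inj₂ (u , K , t′ , ks , r) | r′ = inj₂ (u , K , t′ , ks , ⊑-trans r′ r)

    Absorbed : V → List V → List (List V) → Set
    Absorbed x X F = ∃₂ λ a X′ → ∃ λ F′ → Path N² a x X′ × X ∷ F ⊑ X′ ∷ F′ ×
      ((E a c × All (Free Q) F′) ⊎ (At Q a × All (Free (c ∷ Q)) F′))

    -- Strands at `c` are put in front of `X` as long as its open end is at `c`.
    absorb : ∀ k {x a X F} → length F ≤ k → Path N² a x X → At (c ∷ Q) a → All (Free (c ∷ Q)) F → Absorbed x X F
    absorb k len p at fs with split at | find fs
    ... | inj₂ i | _ = _ , _ , _ , p , ⊑-perm refl , inj₂ (i , fs)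
    ... | inj₁ e | inj₂ gs = _ , _ , _ , p , ⊑-perm refl , inj₁ (e , gs)
    absorb zero {F = []} len p at fs | inj₁ e | inj₁ (_ , _ , _ , _ , () , _)
    absorb (suc k) {X = X} len p at fs | inj₁ e | inj₁ (s , G , (_ , _ , q , f , at′) , gs , eq , ref)
      with a , X′ , F′ , p′ , ref′ , r ← absorb k (fewer len eq) (rev-join q f e p) at′ gs =
      a , X′ , F′ , p′ ,
      ⊑-trans (⊑-cons X ref) (⊑-trans (⊑-perm (swap X s refl)) (⊑-trans ⊑-reverse (⊑-trans ⊑-join ref′))) , r

  join-two : ∀ {x y a b X Y} → Path N² a x X → N² a b → Path N² b y Y → Linkable x y (X ∷ Y ∷ [])
  join-two {X = X} {Y} p r q = link-reverse (link-join (reverse X ++ Y , path-++ (path-reverse N²-sym p) r q ,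
    ↭-reflexive (≡.sym (++-identityʳ _)) , λ { (here a) → a ; (there ()) }))

  -- One step of the sweep.

  module Step (c : V) (Q : List V) (linked : Linked E (c ∷ Q)) (IH : Solve Q) where

    open Solve IH
    open Locate c Q

    -- The end attached to `Q` only shows that `Q` has a first vertex; `c` is adjacent to it.
    next-At : ∀ {e} → At Q e → At Q c
    next-At = go linked
      where
      go : ∀ {Q e} → Linked E (c ∷ Q) → At Q e → At Q c
      go (r ∷ _) _ = here r

    next-Rear : ∀ {e p} → At Q e → E p c → Rear Q p
    next-Rear = go linked
      where
      go : ∀ {Q e p} → Linked E (c ∷ Q) → At Q e → E p c → Rear Q p
      go (r ∷ _) _ s = inj₂ (c , s , r)

    -- If no vertex is left, `M` and `Y` complete the path. Otherwise `c` is attached to the next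
    -- vertex, and `Y`, whose end is at `c`, becomes the rear end.
    finish : ∀ R {x y b M Y F} → Linked E (c ∷ R) → Solve R → Path N² c x M → Path N² b y Y → E b c →
             All (Free R) F → Linkable x y (conf M Y F R)
    finish [] _ _ p q e [] = join-two p (inj₁ (E-sym e)) q
    finish [] _ _ _ _ _ ((_ , _ , _ , () , _) ∷ _)
    finish (d ∷ R) (r ∷ _) ih p q e fs =
      swapXY (d ∷ R) (Solve.rearX ih q (inj₂ (c , e , r)) p (here r) fs)

    -- c has just been appended to M.  An attached strand may be joined to c unless it is Y, since joining Y would
    -- complete the path prematurely; then c moves on to the next vertex of Q and Y becomes the rear end.
    mid : ∀ k {x y b M Y F} → length F ≤ k → Path N² c x M → Path N² b y Y → At (c ∷ Q) b →
          All (Free (c ∷ Q)) F → Linkable x y (conf M Y F Q)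
    mid k len p q at-b fs with split at-b | find fs
    mid zero {F = []} len p q at-b fs | _ | inj₁ (_ , _ , _ , _ , () , _)
    mid (suc k) len p q at-b fs | inj₁ e | inj₁ (s , G , (_ , _ , t , f , at-t) , gs , eq , ref) =
      lift-link ref _ (swapXY Q (joinX-rev Q (swapXY Q (mid k (fewer len eq) p (rev-join t f e q) at-t gs))))
    mid k len p q at-b fs | inj₁ e | inj₂ gs = finish Q linked IH p q e gs
    mid (suc k) len p q at-b fs | inj₂ i | inj₁ (s , G , (a , b , t , f , at-t) , gs , eq , ref)
      with find gs
    ... | inj₁ (s′ , H , (_ , _ , t′ , f′ , at-t′) , hs , eq′ , ref′) =
      lift-link ref _ (toFront Q (lift-link ref′ (s ∷ _) (fromFront Q (joinF-rev Q
        (mid k (subst (_≤ k) eq′ (fewer len eq)) p q at-b ((_ , _ , rev-join t′ f′ f t , at-t′ , at-t) ∷ hs))))))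
    ... | inj₂ hs with split at-t
    -- The strand has both ends at `c`: one is joined to `c`, the other becomes the rear end.
    ...   | inj₁ g = lift-link ref _ (joinX-rev Q (rearX (path-++ (path-reverse N²-sym t) (inj₁ f) p) (next-Rear i g) q i hs))
    ...   | inj₂ j = lift-link ref _ (joinX-rev Q (none (path-++ (path-reverse N²-sym t) (inj₁ f) p) j q i hs))
    mid k len p q at-b fs | inj₂ i | inj₂ gs = none p (next-At i) q i gs

    -- Here `c` opens the free strand `M`, and `X` and `Y` are both still open. Strands at `c` are
    -- joined to `X` or `Y` if one of these is at `c`, otherwise to `M` or to each other, so that at
    -- most one rear end remains.
    midF : ∀ k {x y a b e X Y M F} → length F ≤ k → Path N² a x X → At (c ∷ Q) a → Path N² b y Y → At (c ∷ Q) b →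
           Path N² c e M → At (c ∷ Q) e → All (Free (c ∷ Q)) F → Linkable x y (conf X Y (M ∷ F) Q)
    midF-here : ∀ k {x y a b e X Y M F} → length F ≤ k → Path N² a x X → E a c → Path N² b y Y → At (c ∷ Q) b →
                Path N² c e M → At (c ∷ Q) e → All (Free (c ∷ Q)) F → Linkable x y (conf X Y (M ∷ F) Q)

    midF-here k len p ea q at-b m at-e fs with find fs | split at-e | split at-b
    midF-here zero {F = []} len p ea q at-b m at-e fs | inj₁ (_ , _ , _ , _ , () , _) | _ | _
    midF-here (suc k) {X = X} {Y} {M} len p ea q at-b m at-e fs
      | inj₁ (s , G , (_ , _ , t , f , at-t) , gs , eq , ref) | _ | _ =
      toFront Q (lift-link ref (M ∷ X ∷ Y ∷ _) (fromFront Q (permF Q (swap s M refl) (joinX-rev Q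
        (midF k (fewer len eq) (rev-join t f ea p) at-t q at-b m at-e gs)))))
    -- Joining the far end of `M` to `X` makes `c` the open end, which is the situation of `mid`.
    midF-here k len p ea q at-b m at-e fs | inj₂ gs | inj₁ g | _ =
      joinX Q (mid k len (path-++ m (via c g ea) p) q at-b fs)
    midF-here k len p ea q at-b m at-e fs | inj₂ gs | inj₂ j | inj₁ g =
      joinX-rev Q (swapXY Q (rearX q (next-Rear j g) (path-++ (path-reverse N²-sym m) (inj₁ (E-sym ea)) p) j gs))
    midF-here k len p ea q at-b m at-e fs | inj₂ gs | inj₂ j | inj₂ i =
      joinX-rev Q (none (path-++ (path-reverse N²-sym m) (inj₁ (E-sym ea)) p) j q i gs)

    midF k len p at-a q at-b m at-e fs with split at-a | split at-b
    ... | inj₁ e | _      = midF-here k len p e q at-b m at-e fs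
    ... | inj₂ _ | inj₁ e = swapXY Q (midF-here k len q e p at-a m at-e fs)
    ... | inj₂ i | inj₂ j with find fs | split at-e
    -- Only `M` is left at `c`; its far end becomes the rear end, while `c` is attached to the next
    -- vertex.
    midF k len p at-a q at-b m at-e fs | inj₂ i | inj₂ j | inj₂ gs | inj₁ g =
      revF Q (rearF p i q j (path-reverse N²-sym m) (next-Rear i g) (next-At i) gs)
    midF k len p at-a q at-b m at-e fs | inj₂ i | inj₂ j | inj₂ gs | inj₂ l =
      none p i q j ((_ , _ , m , next-At i , l) ∷ gs)
    midF zero {F = []} len p at-a q at-b m at-e fs | inj₂ i | inj₂ j | inj₁ (_ , _ , _ , _ , () , _) | _
    midF (suc k) {X = X} {Y} {M} len p at-a q at-b m at-e fs | inj₂ i | inj₂ j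
      | inj₁ (s , G , (_ , _ , t , f , at-t) , gs , eq , ref) | inj₁ g =
      toFront Q (lift-link ref (M ∷ X ∷ Y ∷ _) (fromFront Q (joinF Q
        (midF k (fewer len eq) p at-a q at-b (path-++ m (via c g f) t) at-t gs))))
    midF (suc k) {X = X} {Y} {M} len p at-a q at-b m at-e fs | inj₂ i | inj₂ j
      | inj₁ (s , G , (_ , _ , t , f , at-t) , gs , eq , ref) | inj₂ l with find gs | split at-t
    ... | inj₁ (s′ , H , (_ , _ , t′ , f′ , at-t′) , hs , eq′ , ref′) | _ =
      toFront Q (lift-link ref (M ∷ X ∷ Y ∷ map [_] Q) (fromFront Q (permF Q (swap s M refl) (link-perm (shifts (s ∷ M ∷ []) (X ∷ Y ∷ map [_] Q))
        (lift-link ref′ (s ∷ M ∷ X ∷ Y ∷ map [_] Q) (link-perm (shifts (X ∷ Y ∷ map [_] Q) (s ∷ M ∷ []))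
          (permF Q (prep s (swap s′ M refl)) (joinF-rev Q (permF Q (swap M _ refl)
            (midF k (subst (_≤ k) eq′ (fewer len eq)) p at-a q at-b m at-e
              ((_ , _ , rev-join t′ f′ f t , at-t′ , at-t) ∷ hs)))))))))))
    ... | inj₂ hs | inj₁ g =
      toFront Q (lift-link ref (M ∷ X ∷ Y ∷ _) (fromFront Q (joinF-rev Q
        (rearF p i q j (path-++ (path-reverse N²-sym t) (inj₁ f) m) (next-Rear i g) l hs))))
    ... | inj₂ hs | inj₂ h =
      toFront Q (lift-link ref (M ∷ X ∷ Y ∷ _) (fromFront Q (joinF-rev Q
        (none p i q j ((_ , _ , path-++ (path-reverse N²-sym t) (inj₁ f) m , h , l) ∷ hs)))))

    extend : Solve (c ∷ Q)
    extend = record { none = none′ ; rearX = rearX′ ; rearF = rearF′ }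
      where
      rearX′ : ∀ {x y a b X Y F} → Path N² a x X → N² a c → Path N² b y Y → At (c ∷ Q) b →
               All (Free (c ∷ Q)) F → Linkable x y (conf X Y F (c ∷ Q))
      rearX′ p r q at-b fs = takeX c Q (mid _ ℕ.≤-refl (N²-sym r ∷ p) q at-b fs)

      rearF′ : ∀ {x y a b r q X Y s F} → Path N² a x X → At (c ∷ Q) a → Path N² b y Y → At (c ∷ Q) b →
               Path N² r q s → N² r c → At (c ∷ Q) q →
               All (Free (c ∷ Q)) F → Linkable x y (conf X Y (s ∷ F) (c ∷ Q))
      rearF′ p at-a q at-b m r at-e fs = takeF c Q (midF _ ℕ.≤-refl p at-a q at-b (N²-sym r ∷ m) at-e fs)

      none′ : ∀ {x y a b X Y F} → Path N² a x X → At (c ∷ Q) a → Path N² b y Y → At (c ∷ Q) b →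
              All (Free (c ∷ Q)) F → Linkable x y (conf X Y F (c ∷ Q))
      none′ p at-a q at-b fs with split at-a | split at-b | find fs
      ... | inj₁ e | _      | _ = rearX′ p (inj₁ e) q at-b fs
      ... | inj₂ _ | inj₁ e | _ = swapXY (c ∷ Q) (rearX′ q (inj₁ e) p at-a fs)
      -- Nothing is attached to `c`, which becomes a strand of one vertex with both ends at the next
      -- vertex of `Q`.
      ... | inj₂ i | inj₂ j | inj₂ gs = newF c Q (none p i q j ((c , c , end c , next-At i , next-At i) ∷ gs))
      ... | inj₂ _ | inj₂ _ | inj₁ (s , G , (_ , _ , t , f , at-t) , gs , eq , ref) =
        lift-link ref (_ ∷ _ ∷ map [_] (c ∷ Q)) (rearF′ p at-a q at-b t (inj₁ f) at-t gs)

  solve : ∀ Q → Linked E Q → Solve Q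
  solve []      _ = solve-[]
  solve (c ∷ Q) l = Step.extend c Q l (solve Q (tail l))
    where
    tail : ∀ {c Q} → Linked E (c ∷ Q) → Linked E Q
    tail [-]     = []
    tail (_ ∷ l) = l

-- Duplicate-free lists and permutations.

module _ {V : Set} where

  unique-↭ : ∀ {A B : List V} → A ↭ B → Unique A → Unique B
  unique-↭ refl u = u
  unique-↭ (prep x p) (a ∷ u) = All-resp-↭ p a ∷ unique-↭ p u
  unique-↭ (swap x y p) ((n ∷ a) ∷ b ∷ u) =
    ((λ e → n (≡.sym e)) ∷ All-resp-↭ p b) ∷ All-resp-↭ p a ∷ unique-↭ p u
  unique-↭ (trans p q) u = unique-↭ q (unique-↭ p u)

  unique-head : ∀ {x : V} {A} → Unique (x ∷ A) → x ∉ A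
  unique-head (a ∷ _) i = All.lookup a i ≡.refl

  unique-++ˡ : ∀ (A : List V) {B} → Unique (A ++ B) → Unique A
  unique-++ˡ [] u = []
  unique-++ˡ (x ∷ A) (a ∷ u) = All.++⁻ˡ A a ∷ unique-++ˡ A u

  unique-++ʳ : ∀ (A : List V) {B} → Unique (A ++ B) → Unique B
  unique-++ʳ [] u = u
  unique-++ʳ (x ∷ A) (_ ∷ u) = unique-++ʳ A u

  unique-disjoint : ∀ (A : List V) {B x} → Unique (A ++ B) → x ∈ A → x ∈ B → ⊥
  unique-disjoint (x ∷ A) u (here ≡.refl) j = unique-head u (∈-++⁺ʳ A j)
  unique-disjoint (x ∷ A) (_ ∷ u) (there i) j = unique-disjoint A u i j

  pick : ∀ {P : V → Set} {A} → Any P A → ∃₂ λ r B → P r × A ↭ r ∷ B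
  pick (here p) = _ , _ , p , refl
  pick {A = x ∷ A} (there i) with r , B , p , σ ← pick i = r , x ∷ B , p , trans (prep x σ) (swap x r refl)

  remove : ∀ {x : V} {A} → x ∈ A → ∃ λ B → A ↭ x ∷ B
  remove i with _ , B , ≡.refl , σ ← pick i = B , σ

  ∈-∷⁻ : ∀ {x y : V} {A} → x ∈ y ∷ A → x ≢ y → x ∈ A
  ∈-∷⁻ (here e)  n = ⊥-elim (n e)
  ∈-∷⁻ (there i) n = i

  scan : ∀ {P : V → Set} {Q : Set} A → (∀ {x} → x ∈ A → P x ⊎ Q) → (∀ {x} → x ∈ A → P x) ⊎ Q
  scan [] f = inj₁ λ ()
  scan (x ∷ A) f with f (here ≡.refl) | scan A (f ∘ there)
  ... | inj₂ q | _      = inj₂ q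
  ... | inj₁ _ | inj₂ q = inj₂ q
  ... | inj₁ p | inj₁ g = inj₁ λ { (here ≡.refl) → p ; (there i) → g i }

  path-start : ∀ {R : V → V → Set} {a b l} → Path R a b l → ∃ λ m → l ≡ a ∷ m
  path-start (end a) = [] , ≡.refl
  path-start (_ ∷ _) = _ , ≡.refl

  edge-glue : ∀ {R : V → V → Set} {a b u v l m} → Path R a b l → Edge u v (b ∷ m) → Edge u v (l ++ m)
  edge-glue (end _) e = e
  edge-glue (_ ∷ p) e = next (edge-glue p e)

-- Connectivity, separation and chains of blocks.

module Connect {V : Set} (E : V → V → Set) (E-sym : ∀ {u v} → E u v → E v u) where

  data Conn (P : V → Set) : V → V → Set where
    stop : ∀ {u} → P u → Conn P u u
    step : ∀ {u v w} → P u → E u v → Conn P v w → Conn P u w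

  module _ {P : V → Set} where

    conn-source : ∀ {u w} → Conn P u w → P u
    conn-source (stop p)     = p
    conn-source (step p _ _) = p

    conn-target : ∀ {u w} → Conn P u w → P w
    conn-target (stop p)     = p
    conn-target (step _ _ c) = conn-target c

    conn-trans : ∀ {u v w} → Conn P u v → Conn P v w → Conn P u w
    conn-trans (stop _)     d = d
    conn-trans (step p e c) d = step p e (conn-trans c d)

    conn-sym : ∀ {u w} → Conn P u w → Conn P w u
    conn-sym (stop p)     = stop p
    conn-sym (step p e c) = conn-trans (conn-sym c) (step (conn-source c) (E-sym e) (stop p))

    conn-snoc : ∀ {u v w} → Conn P u v → E v w → P w → Conn P u w
    conn-snoc c e p = conn-trans c (step (conn-target c) e (stop p))

    conn-map : ∀ {Q : V → Set} → (∀ {x} → P x → Q x) → ∀ {u w} → Conn P u w → Conn Q u w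
    conn-map f (stop p)     = stop (f p)
    conn-map f (step p e c) = step (f p) e (conn-map f c)

    -- The walk is cut where it first leaves `I`. This is how 2-connectedness is exploited: a walk
    -- avoiding one vertex has to leave a separated part elsewhere.
    exit : ∀ {I T : V → Set} → (∀ {a b} → I a → P b → E a b → I b ⊎ T b) → ∀ {u w} → I u → Conn P u w →
           Conn (λ x → P x × I x) u w ⊎ ∃₂ λ a t → Conn (λ x → P x × I x) u a × E a t × P t × T t
    exit f i (stop p) = inj₁ (stop (p , i))
    exit f i (step p e c) with f i (conn-source c) e
    ... | inj₂ t = inj₂ (_ , _ , stop (p , i) , e , conn-source c , t)
    ... | inj₁ j with exit f j c
    ...   | inj₁ d = inj₁ (step (p , i) e d)
    ...   | inj₂ (a , t , d , rest) = inj₂ (a , t , step (p , i) e d , rest)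

  infix 4 _∈_∖_
  _∈_∖_ : V → List V → V → Set
  x ∈ A ∖ v = x ∈ A × x ≢ v

  Apart : List V → List V → Set
  Apart C D = ∀ {x y} → x ∈ C → y ∈ D → ¬ E x y

  apart-sym : ∀ {C D} → Apart C D → Apart D C
  apart-sym f i j e = f j i (E-sym e)

  module _ (E? : Decidable E) where

    -- Vertices of `R` adjacent to `C` are moved over one at a time; `C` may start with several
    -- seeds, and `k` bounds the number of moves.
    closure : ∀ k C R → length R ≤ k → ∃₂ λ C′ D → C ++ R ↭ C′ ++ D × (∀ {x} → x ∈ C → x ∈ C′) ×
      (∀ {x} → x ∈ C′ → ∃ λ s → s ∈ C × Conn (_∈ C′) s x) × Apart C′ D
    closure k C R len with Any.any? (λ r → Any.any? (λ c → E? c r) C) R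
    closure k C R len | no ∄ =
      C , R , refl , id , (λ i → _ , i , stop i) , λ i j e → ∄ (Any.map (λ { ≡.refl → Any.map (λ { ≡.refl → e }) i }) j)
    closure zero C [] len | yes ()
    closure (suc k) C R len | yes a
      with r , R′ , a′ , σ ← pick a
      with C′ , D , τ , inc , reach , apart ← closure k (r ∷ C) R′ (ℕ.≤-pred (subst (_≤ suc k) (↭-length σ) len)) =
      C′ , D , trans (trans (++⁺ˡ C σ) (shift r C R′)) τ , inc ∘ there , reach′ , apart
      where
      reach′ : ∀ {x} → x ∈ C′ → ∃ λ s → s ∈ C × Conn (_∈ C′) s x
      reach′ i with reach i
      ... | s , there j , c = s , j , c
      ... | s , here ≡.refl , c with c₀ , _ , e , ρ ← pick a′ =
        c₀ , ∈-resp-↭ (↭-sym ρ) (here ≡.refl) , step (inc (there (∈-resp-↭ (↭-sym ρ) (here ≡.refl)))) e c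

    component : ∀ {s A} → s ∈ A → ∃₂ λ C D → A ↭ C ++ D × s ∈ C × (∀ {x} → x ∈ C → Conn (_∈ C) s x) × Apart C D
    component i with R , σ ← remove i
      with C , D , τ , inc , reach , apart ← closure _ [ _ ] R ℕ.≤-refl =
      C , D , trans σ τ , inc (here ≡.refl) , (λ j → from (reach j)) , apart
      where
      from : ∀ {s x C} → ∃ (λ r → r ∈ [ s ] × Conn (_∈ C) r x) → Conn (_∈ C) s x
      from (_ , here ≡.refl , c) = c

  -- A single vertex and two adjacent vertices qualify, so that a bridge counts as a block.
  Bic : List V → Set
  Bic A = (∀ {u w} → u ∈ A → w ∈ A → Conn (_∈ A) u w) ×
          (∀ {v u w} → u ∈ A → w ∈ A → u ≢ v → w ≢ v → Conn (_∈ A ∖ v) u w)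

  -- Adding the edge st to A would leave no cut vertex, i.e. A is a chain of blocks from s to t.
  record St (A : List V) (s t : V) : Set where
    field
      s∈   : s ∈ A
      t∈   : t ∈ A
      s≢t  : s ≢ t
      conn : Conn (_∈ A) s t
      reach : ∀ {v u} → u ∈ A → u ≢ v → Conn (_∈ A ∖ v) u s ⊎ Conn (_∈ A ∖ v) u t

  St-sym : ∀ {A s t} → St A s t → St A t s
  St-sym st = record { s∈ = t∈ ; t∈ = s∈ ; s≢t = s≢t ∘ ≡.sym ; conn = conn-sym conn
    ; reach = λ i n → Sum.swap (reach i n) }
    where open St st

  -- Without edges between `C` and `D`, a walk from `C` towards `t` has to pass `c` and is cut
  -- there.
  St-half : ∀ {A s t c C D} → Unique A → A ↭ c ∷ C ++ D → Apart C D → s ∈ C → t ∈ D → St A s t → St (c ∷ C) s c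
  St-half {A} {s} {t} {c} {C} {D} u σ apart i j st = record
    { s∈ = there i ; t∈ = here ≡.refl ; s≢t = λ { ≡.refl → unique-head u′ (∈-++⁺ˡ i) }
    ; conn = whole ; reach = part }
    where
    open St st
    u′ = unique-↭ σ u
    t∉C : t ∉ C
    t∉C k = unique-disjoint C (unique-++ʳ [ c ] u′) k j
    leave : ∀ {P : V → Set} → (∀ {x} → P x → x ∈ A) → ∀ {a b} → a ∈ C → P b → E a b → b ∈ C ⊎ b ≡ c
    leave f k p e with ∈-resp-↭ σ (f p)
    ... | here b≡c = inj₂ b≡c
    ... | there l with ∈-++⁻ C l
    ...   | inj₁ m = inj₁ m
    ...   | inj₂ m = ⊥-elim (apart k m e)
    whole : Conn (_∈ c ∷ C) s c
    whole with exit (leave id) i conn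
    ... | inj₁ d = ⊥-elim (t∉C (proj₂ (conn-target d)))
    ... | inj₂ (_ , _ , d , e , _ , ≡.refl) = conn-snoc (conn-map (there ∘ proj₂) d) e (here ≡.refl)
    part : ∀ {v u} → u ∈ c ∷ C → u ≢ v → Conn (_∈ c ∷ C ∖ v) u s ⊎ Conn (_∈ c ∷ C ∖ v) u c
    part (here ≡.refl) n = inj₂ (stop (here ≡.refl , n))
    part {v} {u} (there k) n = both (reach (∈-resp-↭ (↭-sym σ) (there (∈-++⁺ˡ k))) n)
      where
      out : ∀ {w} → Conn (_∈ A ∖ v) u w → Conn (_∈ c ∷ C ∖ v) u c ⊎ (w ∈ C × Conn (_∈ c ∷ C ∖ v) u w)
      out c with exit (leave {_∈ A ∖ v} proj₁) k c
      ... | inj₁ d = inj₂ (proj₂ (conn-target d) , conn-map (λ { ((_ , m) , l) → there l , m }) d)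
      ... | inj₂ (_ , _ , d , e , (_ , m) , ≡.refl) =
        inj₁ (conn-snoc (conn-map (λ { ((_ , m) , l) → there l , m }) d) e (here ≡.refl , m))
      both : Conn (_∈ A ∖ v) u s ⊎ Conn (_∈ A ∖ v) u t → Conn (_∈ c ∷ C ∖ v) u s ⊎ Conn (_∈ c ∷ C ∖ v) u c
      both (inj₁ c) with out c
      ... | inj₁ d = inj₂ d
      ... | inj₂ (_ , d) = inj₁ d
      both (inj₂ c) with out c
      ... | inj₁ d = inj₂ d
      ... | inj₂ (l , _) = ⊥-elim (t∉C l)

  record Cut (A : List V) (s t : V) : Set where
    field
      c     : V
      C D   : List V
      perm  : A ↭ c ∷ C ++ D
      s∈C   : s ∈ C
      t∈D   : t ∈ D
      apart : Apart C D
      left  : St (c ∷ C) s c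
      right : St (c ∷ D) c t
    perm′ : A ↭ c ∷ D ++ C
    perm′ = trans perm (prep c (++-comm C D))

  -- After deleting `v`, every vertex is still joined to `s` or to `t`, so `v` can disconnect `A`
  -- only by separating `s` from `t`.
  bic-or-cut : DecidableEquality V → Decidable E → ∀ {A s t} → Unique A → St A s t → Bic A ⊎ Cut A s t
  bic-or-cut _≟_ E? {A} {s} {t} u st with scan A at
    where
    open St st
    at : ∀ {v} → v ∈ A → (s ≢ v → t ≢ v → Conn (_∈ A ∖ v) s t) ⊎ Cut A s t
    at {v} i with v ≟ s | v ≟ t
    ... | yes ≡.refl | _ = inj₁ (λ n → ⊥-elim (n ≡.refl))
    ... | no _ | yes ≡.refl = inj₁ (λ _ n → ⊥-elim (n ≡.refl))
    ... | no v≢s | no v≢t with B , σ ← remove i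
      with C , D , τ , s∈C , reachC , apart ← component E? (∈-∷⁻ (∈-resp-↭ σ s∈) (v≢s ∘ ≡.sym))
      with ∈-++⁻ C (∈-resp-↭ τ (∈-∷⁻ (∈-resp-↭ σ t∈) (v≢t ∘ ≡.sym)))
    ...   | inj₁ t∈C = inj₁ λ _ _ → conn-map inA (reachC t∈C)
      where
      inA : ∀ {x} → x ∈ C → x ∈ A ∖ v
      inA j = ∈-resp-↭ (↭-sym (trans σ (prep v τ))) (there (∈-++⁺ˡ j)) ,
              λ { ≡.refl → unique-head (unique-↭ (trans σ (prep v τ)) u) (∈-++⁺ˡ j) }
    ...   | inj₂ t∈D = inj₂ record { c = v ; C = C ; D = D ; perm = ρ ; s∈C = s∈C ; t∈D = t∈D ; apart = apart
        ; left = St-half u ρ apart s∈C t∈D st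
        ; right = St-sym (St-half u (trans ρ (prep v (++-comm C D))) (apart-sym apart) t∈D s∈C (St-sym st)) }
      where ρ = trans σ (prep v τ)
  ... | inj₂ cut = inj₂ cut
  ... | inj₁ f = inj₁ (plain , avoid)
    where
    open St st
    to-t : ∀ {u} → u ∈ A → Conn (_∈ A) u t
    to-t {u} i with u ≟ s
    ... | yes ≡.refl = conn
    ... | no n with reach i n
    ...   | inj₁ c = ⊥-elim (proj₂ (conn-target c) ≡.refl)
    ...   | inj₂ c = conn-map proj₁ c
    plain : ∀ {u w} → u ∈ A → w ∈ A → Conn (_∈ A) u w
    plain i j = conn-trans (to-t i) (conn-sym (to-t j))
    link : ∀ {v} → s ≢ v → t ≢ v → Conn (_∈ A ∖ v) s t
    link {v} m n with Any.any? (v ≟_) A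
    ... | yes i = f i m n
    ... | no ∄ = conn-map (λ i → i , λ { ≡.refl → ∄ i }) conn
    avoid : ∀ {v u w} → u ∈ A → w ∈ A → u ≢ v → w ≢ v → Conn (_∈ A ∖ v) u w
    avoid {v} i j m n with reach i m | reach j n
    ... | inj₁ c | inj₁ d = conn-trans c (conn-sym d)
    ... | inj₂ c | inj₂ d = conn-trans c (conn-sym d)
    ... | inj₁ c | inj₂ d = conn-trans c (conn-trans (link (proj₂ (conn-target c)) (proj₂ (conn-target d))) (conn-sym d))
    ... | inj₂ c | inj₁ d = conn-trans c (conn-trans (conn-sym (link (proj₂ (conn-target d)) (proj₂ (conn-target c)))) (conn-sym d))

-- The strong property and the induction hypothesis.

record Rel (V : Set) : Set₁ where
  field
    E     : V → V → Set
    E?    : Decidable E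
    E-sym : ∀ {u v} → E u v → E v u

module Notions {V : Set} (G : Rel V) where
  open Rel G public
  open Sweep E E-sym public
  open Connect E E-sym public

  -- Taking the edge we inside T rather than x ∷ T makes it different from the first edge xz.
  Strong : List V → V → V → V → Set
  Strong A x y w = ∃ λ z → ∃₂ λ T e → E x z × Path N² z y T × x ∷ T ↭ A × E w e × Edge w e T

  -- Keeping `x` apart from `T` allows the path to be appended to another one that ends in `x`.
  First : List V → V → V → Set
  First A x y = ∃₂ λ z T → E x z × Path N² z y T × x ∷ T ↭ A

  Slot : List V → V → V → V → Set
  Slot A x y w = ∃₂ λ P e → Path N² x y P × P ↭ A × E w e × Edge w e P

-- The relation varies too, since contraction changes the adjacency on the same type `V`.
Hyp : Set → ℕ → Set₁
Hyp V n = (G : Rel V) → let open Notions G in ∀ {A x y w} → length A < n → Unique A → Bic A →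
  x ∈ A → y ∈ A → w ∈ A → x ≢ y → x ≢ w → y ≢ w → Strong A x y w

-- Hamiltonian paths along a chain of blocks.

module Chain {V : Set} (_≟_ : DecidableEquality V) {n : ℕ} (IH : Hyp V n) (G : Rel V) where
  open Notions G

  -- A block that is a single edge offers no third vertex for the induction hypothesis.
  first-of-two : ∀ {A s t} → A ↭ s ∷ t ∷ [] → St A s t → First A s t
  first-of-two {A} {s} {t} σ st = t , [ t ] , edge , end t , ↭-sym σ
    where
    open St st
    leave : ∀ {a b} → a ≡ s → b ∈ A → E a b → b ≡ s ⊎ b ≡ t
    leave _ j _ with ∈-resp-↭ σ j
    ... | here p = inj₁ p
    ... | there (here p) = inj₂ p
    edge : E s t
    edge with exit leave ≡.refl conn
    ... | inj₁ c = ⊥-elim (s≢t (≡.sym (proj₂ (conn-target c))))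
    ... | inj₂ (_ , _ , c , e , _ , ≡.refl) with ≡.refl ← proj₂ (conn-target c) = e

  third : ∀ {A : List V} {s t} → s ∈ A → t ∈ A → s ≢ t → ∃ λ R → A ↭ s ∷ t ∷ R
  third i j n with B , σ ← remove i with C , τ ← remove (∈-∷⁻ (∈-resp-↭ σ j) (n ∘ ≡.sym)) = C , trans σ (prep _ τ)

  module _ {A : List V} {c C D} {s t : V} (σ : A ↭ c ∷ C ++ D) (s∈C : s ∈ C) (t∈D : t ∈ D) where

    left-shorter : ∀ {k} → length A ≤ suc k → length (c ∷ C) ≤ k
    left-shorter le with s≤s le′ ← subst (_≤ _) (≡.trans (↭-length σ) (cong suc (length-++ C))) le =
      ℕ.≤-trans (ℕ.≤-trans (ℕ.≤-reflexive (ℕ.+-comm 1 _)) (ℕ.+-monoʳ-≤ (length C) (∈-length t∈D))) le′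

    glue-perm : ∀ {P Q} → P ↭ c ∷ C → c ∷ Q ↭ c ∷ D → P ++ Q ↭ A
    glue-perm {P} {Q} π ρ = trans (++⁺ π (drop-∷ ρ)) (↭-sym σ)

  unique-left : ∀ {A c} {C D : List V} → A ↭ c ∷ C ++ D → Unique A → Unique (c ∷ C)
  unique-left {c = c} {C} σ u = unique-++ˡ (c ∷ C) (unique-↭ σ u)

  -- In a block any third vertex will do for the induction hypothesis. At a cut vertex the right
  -- half is entered by its first edge, which lies in `E`.
  chain-first : ∀ k {A s t} → length A ≤ k → k < n → Unique A → St A s t → First A s t
  chain-first zero {[]} le lt u st with () ← St.s∈ st
  chain-first (suc k) {A} {s} {t} le lt u st with bic-or-cut _≟_ E? u st
  ... | inj₁ bic with third (St.s∈ st) (St.t∈ st) (St.s≢t st)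
  ...   | [] , σ = first-of-two σ st
  ...   | r ∷ _ , σ with (n₁ ∷ n₂ ∷ _) ∷ (n₃ ∷ _) ∷ _ ← unique-↭ σ u
    with z , T , _ , e , p , π , _ ← IH G (ℕ.≤-<-trans le lt) u bic (St.s∈ st) (St.t∈ st)
           (∈-resp-↭ (↭-sym σ) (there (there (here ≡.refl)))) n₁ n₂ n₃ = z , T , e , p , π
  chain-first (suc k) {A} {s} {t} le lt u st | inj₂ cut = join
    (chain-first k (left-shorter perm s∈C t∈D le) lt′ (unique-left perm u) left)
    (chain-first k (left-shorter perm′ t∈D s∈C le) lt′ (unique-left perm′ u) right)
    where
    open Cut cut
    lt′ = ℕ.<-trans ℕ.≤-refl lt
    join : First (c ∷ C) s c → First (c ∷ D) c t → First A s t
    join (z , T , e , p , π) (z′ , T′ , e′ , p′ , π′) =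
      z , T ++ T′ , e , path-++ p (inj₁ e′) p′ , glue-perm perm s∈C t∈D π π′

  -- If `w` is the cut vertex, the first edge of the right half is its edge; otherwise the recursion
  -- enters the half containing `w`, and the other half is merely traversed.
  chain-slot : ∀ k {A s t w} → length A ≤ k → k < n → Unique A → St A s t → w ∈ A → w ≢ s → w ≢ t → Slot A s t w
  chain-slot zero {[]} le lt u st ()
  chain-slot (suc k) {A} {s} {t} {w} le lt u st i m m′ with bic-or-cut _≟_ E? u st
  ... | inj₁ bic with z , T , e , f , p , π , g , h ← IH G (ℕ.≤-<-trans le lt) u bic (St.s∈ st) (St.t∈ st) i
                        (St.s≢t st) (m ∘ ≡.sym) (m′ ∘ ≡.sym) = s ∷ T , e , inj₁ f ∷ p , π , g , next h
  ... | inj₂ cut = go (∈-resp-↭ perm i)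
    where
    open Cut cut
    lt′ = ℕ.<-trans ℕ.≤-refl lt
    lenL = left-shorter perm s∈C t∈D le
    lenR = left-shorter perm′ t∈D s∈C le
    uL = unique-left perm u
    uR = unique-left perm′ u
    firstR : First (c ∷ D) c t
    firstR = chain-first k lenR lt′ uR right
    firstL : First (c ∷ C) s c
    firstL = chain-first k lenL lt′ uL left
    inL : w ∈ c ∷ C → w ≢ c → Slot A s t w
    inL j n with P , e , p , π , f , g ← chain-slot k lenL lt′ uL left j m n
      with z′ , T′ , e′ , p′ , π′ ← firstR =
      P ++ T′ , e , path-++ p (inj₁ e′) p′ , glue-perm perm s∈C t∈D π π′ , f , edge-++ˡ T′ g
    inR : w ∈ c ∷ D → w ≢ c → Slot A s t w
    inR j n with P , e , p , π , f , g ← chain-slot k lenR lt′ uR right j n m′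
      with _ , ≡.refl ← path-start p
      with z , T , h , q , ρ ← firstL =
      _ , e , path-glue (inj₁ h ∷ q) p , glue-perm perm s∈C t∈D ρ π , f , next (edge-glue q g)
    go : w ∈ c ∷ C ++ D → Slot A s t w
    go (here ≡.refl) with z , T , h , q , ρ ← firstL with z′ , T′ , e′ , p′ , π′ ← firstR =
      s ∷ T ++ T′ , z′ , inj₁ h ∷ path-++ q (inj₁ e′) p′ , glue-perm perm s∈C t∈D ρ π′ , e′ , next (edge-first q p′)
      where
      edge-first : ∀ {a b x y l m} → Path N² a b l → Path N² x y m → Edge b x (l ++ m)
      edge-first q p with _ , ≡.refl ← path-start p = edge-glue q fwd
    go (there j) with ∈-++⁻ C j
    ... | inj₁ l = inL (there l) λ { ≡.refl → unique-head (unique-↭ perm u) (∈-++⁺ˡ l) }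
    ... | inj₂ l = inR (there l) λ { ≡.refl → unique-head (unique-↭ perm u) (∈-++⁺ʳ C l) }

  -- The start z is not prescribed but must lie, up to the condition N, in the block of the chain that contains s.
  chain-from : ∀ (N : V → Set) k {A s t} → length A ≤ k → k < n → Unique A → St A s t →
    (∃ λ z → z ∈ A × N z × z ≢ t) →
    (∀ {c C D} → A ↭ c ∷ C ++ D → s ∈ C → t ∈ D → Apart C D → ∃ λ z → z ∈ C × N z) →
    ∃ λ z → N z × Slot A z t s
  chain-from N zero {[]} le lt u st with () ← St.s∈ st
  chain-from N (suc k) {A} {s} {t} le lt u st (z , i , Nz , z≢t) cuts with bic-or-cut _≟_ E? u st
  ... | inj₁ bic with z ≟ s
  ...   | yes ≡.refl with z′ , T , e , p , π ← chain-first (suc k) le lt u st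
                     with _ , ≡.refl ← path-start p = z , Nz , z ∷ T , z′ , inj₁ e ∷ p , π , e , fwd
  ...   | no n with z′ , T , e , f , p , π , g , h ←
                   IH G (ℕ.≤-<-trans le lt) u bic i (St.t∈ st) (St.s∈ st) z≢t n (St.s≢t st ∘ ≡.sym) =
    z , Nz , z ∷ T , e , inj₁ f ∷ p , π , g , next h
  chain-from N (suc k) {A} {s} {t} le lt u st _ cuts | inj₂ cut = join
    (chain-from N k (left-shorter perm s∈C t∈D le) lt′ (unique-left perm u) left
      (start (cuts perm s∈C t∈D apart)) cuts′)
    (chain-first k (left-shorter perm′ t∈D s∈C le) lt′ (unique-left perm′ u) right)
    where
    open Cut cut
    lt′ = ℕ.<-trans ℕ.≤-refl lt
    start : (∃ λ z → z ∈ C × N z) → ∃ λ z → z ∈ c ∷ C × N z × z ≢ c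
    start (z , i , Nz) = z , there i , Nz , λ { ≡.refl → unique-head (unique-↭ perm u) (∈-++⁺ˡ i) }
    join : (∃ λ z → N z × Slot (c ∷ C) z c s) → First (c ∷ D) c t → ∃ λ z → N z × Slot A z t s
    join (z , Nz , P , e , p , π , f , g) (z′ , T′ , e′ , p′ , π′) =
      z , Nz , P ++ T′ , e , path-++ p (inj₁ e′) p′ , glue-perm perm s∈C t∈D π π′ , f , edge-++ˡ T′ g
    cuts′ : ∀ {c′ C′ D′} → c ∷ C ↭ c′ ∷ C′ ++ D′ → s ∈ C′ → c ∈ D′ → Apart C′ D′ → ∃ λ z → z ∈ C′ × N z
    cuts′ {c′} {C′} {D′} σ i j apart′ =
      cuts (trans perm (trans (++⁺ʳ D σ) (prep c′ (↭-reflexive (++-assoc C′ D′ D))))) i (∈-++⁺ʳ D′ t∈D) apart″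
      where
      -- `C′` does not contain `c`, hence lies in `C` and has no edges to `D`.
      apart″ : Apart C′ (D′ ++ D)
      apart″ x y with ∈-++⁻ D′ y
      ... | inj₁ y′ = apart′ x y′
      ... | inj₂ y′ = apart (∈-∷⁻ (∈-resp-↭ (↭-sym σ) (there (∈-++⁺ˡ x)))
          λ { ≡.refl → unique-disjoint C′ (unique-++ʳ [ c′ ] (unique-↭ σ (unique-left perm u))) x j }) y′

-- Strands from contracted components.

module _ {V : Set} {u v : V} where

  edge-source : ∀ {l} → Edge u v l → u ∈ l
  edge-source fwd      = here ≡.refl
  edge-source bwd      = there (here ≡.refl)
  edge-source (next e) = there (edge-source e)

  edge-target : ∀ {l} → Edge u v l → v ∈ l
  edge-target fwd      = there (here ≡.refl)
  edge-target bwd      = here ≡.refl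
  edge-target (next e) = there (edge-target e)

module Strands {V : Set} (_≟_ : DecidableEquality V) {n : ℕ} (IH : Hyp V n) (G : Rel V)
               (R : List V) (r₀ : V) where
  open Notions G

  -- No vertex separates part of U from R; this makes the contraction of R in U ∪ R free of cut vertices in U.
  Attached : List V → Set
  Attached U = ∀ {v u} → u ∈ U → u ≢ v → ∃ λ a → Conn (_∈ U ∖ v) u a × At R a

  Partition : List V → Set
  Partition U = ∃ λ F → concat F ↭ U × All (Free R) F

  Partition-slot : List V → V → Set
  Partition-slot U y = ∃ λ F → concat F ↭ U × All (Free R) F × ∃ λ e → E y e × Any (Edge y e) F

  attached-part : ∀ {U C D} → U ↭ C ++ D → Apart C D → Attached U → Attached C
  attached-part {U} {C} {D} σ apart att {v} i n
    with a , c , r ← att (∈-resp-↭ (↭-sym σ) (∈-++⁺ˡ i)) n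
    with exit {I = _∈ C} {T = λ _ → ⊥} leave i c
    where
    leave : ∀ {a b} → a ∈ C → b ∈ U ∖ v → E a b → b ∈ C ⊎ ⊥
    leave k (l , _) e with ∈-++⁻ C (∈-resp-↭ σ l)
    ... | inj₁ m = inj₁ m
    ... | inj₂ m = ⊥-elim (apart k m e)
  ... | inj₁ d = a , conn-map (λ { ((_ , m) , l) → l , m }) d , r
  ... | inj₂ (_ , _ , _ , _ , _ , ())

  module Contract (C : List V) (r₀∉C : r₀ ∉ C) where

    -- The contraction of `R` to the vertex `r₀`, restricted to `C` and `r₀`.
    E′ : V → V → Set
    E′ u v = (u ∈ C × v ∈ C × E u v) ⊎ (u ≡ r₀ × v ∈ C × At R v) ⊎ (v ≡ r₀ × u ∈ C × At R u)

    E′? : Decidable E′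
    E′? u v = (u ∈? C ×-dec v ∈? C ×-dec E? u v)
      ⊎-dec (u ≟ r₀ ×-dec v ∈? C ×-dec Any.any? (E? v) R)
      ⊎-dec (v ≟ r₀ ×-dec u ∈? C ×-dec Any.any? (E? u) R)
      where
      open import Data.List.Membership.DecPropositional _≟_ using (_∈?_)

    E′-sym : ∀ {u v} → E′ u v → E′ v u
    E′-sym (inj₁ (i , j , e)) = inj₁ (j , i , E-sym e)
    E′-sym (inj₂ (inj₁ x))    = inj₂ (inj₂ x)
    E′-sym (inj₂ (inj₂ x))    = inj₂ (inj₁ x)

    G′ : Rel V
    G′ = record { E = E′ ; E? = E′? ; E-sym = E′-sym }

    module G′ = Notions G′

    conn′ : ∀ {P : V → Set} {u w} → (∀ {x} → P x → x ∈ C) → Conn P u w → G′.Conn P u w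
    conn′ f (stop p)     = G′.stop p
    conn′ f (step p e c) = G′.step p (inj₁ (f p , f (conn-source c) , e)) (conn′ f c)

    -- Deleting a vertex other than `r₀` leaves the rest joined to `r₀` by attachment; deleting `r₀`
    -- leaves the connected `C`.
    bic : (∀ {u w} → u ∈ C → w ∈ C → Conn (_∈ C) u w) → Attached C → G′.Bic (r₀ ∷ C)
    bic conn att = (λ i j → G′.conn-trans (plain i) (G′.conn-sym (plain j))) , avoid
      where
      outside : ∀ {x} → x ∈ C → x ≢ r₀
      outside i ≡.refl = r₀∉C i
      toRoot : ∀ {v u} → v ≢ r₀ → u ∈ r₀ ∷ C → u ≢ v → G′.Conn (G′._∈ r₀ ∷ C ∖ v) u r₀
      toRoot m (here ≡.refl) _ = G′.stop (here ≡.refl , m ∘ ≡.sym)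
      toRoot m (there i) n with a , c , r ← att i n =
        G′.conn-snoc (G′.conn-map (λ { (j , l) → there j , l }) (conn′ proj₁ c))
          (inj₂ (inj₂ (≡.refl , proj₁ (conn-target c) , r))) (here ≡.refl , m ∘ ≡.sym)
      plain : ∀ {u} → u ∈ r₀ ∷ C → G′.Conn (_∈ r₀ ∷ C) u r₀
      plain (here ≡.refl) = G′.stop (here ≡.refl)
      plain (there i) with a , c , r ← att i (outside i) =
        G′.conn-snoc (G′.conn-map (there ∘ proj₁) (conn′ proj₁ c))
          (inj₂ (inj₂ (≡.refl , proj₁ (conn-target c) , r))) (here ≡.refl)
      avoid : ∀ {v u w} → u ∈ r₀ ∷ C → w ∈ r₀ ∷ C → u ≢ v → w ≢ v → G′.Conn (G′._∈ r₀ ∷ C ∖ v) u w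
      avoid {v} i j m n with v ≟ r₀
      ... | no v≢ = G′.conn-trans (toRoot v≢ i m) (G′.conn-sym (toRoot v≢ j n))
      ... | yes ≡.refl = G′.conn-map (λ k → there k , outside k) (conn′ id (conn (∈-∷⁻ i m) (∈-∷⁻ j n)))

    inner : ∀ {u v} → u ∈ C → v ∈ C → E′ u v → E u v
    inner i j (inj₁ (_ , _ , e))           = e
    inner i j (inj₂ (inj₁ (≡.refl , _ , _))) = ⊥-elim (r₀∉C i)
    inner i j (inj₂ (inj₂ (≡.refl , _ , _))) = ⊥-elim (r₀∉C j)

    -- A step through a middle vertex in `C` is one of the original graph; if the middle vertex is
    -- `r₀`, both ends are attached to `R`.
    near : ∀ {u v} → u ∈ C → v ∈ C → G′.N² u v → N² u v ⊎ (At R u × At R v)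
    near i j (inj₁ e) = inj₁ (inj₁ (inner i j e))
    near i j (inj₂ (m , inj₁ (_ , k , e) , f)) = inj₁ (inj₂ (m , e , inner k j f))
    near i j (inj₂ (m , inj₂ (inj₁ (≡.refl , _ , _)) , f)) = ⊥-elim (r₀∉C i)
    near i j (inj₂ (m , inj₂ (inj₂ (≡.refl , _ , a)) , inj₁ (k , _ , _))) = ⊥-elim (r₀∉C k)
    near i j (inj₂ (m , inj₂ (inj₂ (≡.refl , _ , a)) , inj₂ (inj₁ (_ , _ , b)))) = inj₂ (a , b)
    near i j (inj₂ (m , inj₂ (inj₂ (≡.refl , _ , a)) , inj₂ (inj₂ (≡.refl , k , _)))) = ⊥-elim (r₀∉C k)

    Cutup : V → List V → Set
    Cutup z T = ∃₂ λ s F → ∃ λ q → Path N² z q s × At R q × All (Free R) F × concat (s ∷ F) ≡ T ×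
      (∀ {u v} → E u v → Edge u v T → Any (Edge u v) (s ∷ F))

    ext : ∀ {u v z : V} {s F} → Any (Edge u v) (s ∷ F) → Any (Edge u v) ((z ∷ s) ∷ F)
    ext (here g)  = here (next g)
    ext (there g) = there g

    -- A step through `r₀` that is not an edge of `E` is a place to cut: both its vertices are
    -- attached to `R` and become ends of strands.
    cutup : ∀ {z a T} → Path G′.N² z a T → All (_∈ C) T → At R a → Cutup z T
    cutup (end a) _ r = [ a ] , [] , a , end a , r , [] , ≡.refl , λ _ e → here e
    cutup {z} (_∷_ {b = b} {l = l} x p) (i ∷ is) r
      with s , F , q , t , at-q , fs , ≡.refl , edges ← cutup p is r
      with _ , ≡.refl ← path-start t
      -- The edge is tested first, because a step through `r₀` may also be an edge of `E` and must
      -- then be kept.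
      with E? z b | near i (All.head is) x
    ... | yes e | _ = z ∷ s , F , q , inj₁ e ∷ t , at-q , fs , ≡.refl ,
      λ { _ fwd → here fwd ; _ bwd → here bwd ; f (next g) → ext (edges f g) }
    ... | no _ | inj₁ y = z ∷ s , F , q , y ∷ t , at-q , fs , ≡.refl ,
      λ { _ fwd → here fwd ; _ bwd → here bwd ; f (next g) → ext (edges f g) }
    ... | no ∄ | inj₂ (at-z , at-b) = [ z ] , s ∷ F , z , end z , at-z , (b , q , t , at-b , at-q) ∷ fs , ≡.refl ,
      λ { f fwd → ⊥-elim (∄ f) ; f bwd → ⊥-elim (∄ (E-sym f)) ; f (next g) → there (edges f g) }

  -- The path in the contraction starts with an edge at `r₀` and ends in an attached vertex. The
  -- edge at `y` lies in the tail without `r₀`, hence belongs to `E`.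
  component-strands : ∀ {C y} → Unique C → suc (length C) < n → r₀ ∉ C → y ∈ C →
    (∀ {u w} → u ∈ C → w ∈ C → Conn (_∈ C) u w) → Attached C →
    ∃ λ F → concat F ↭ C × All (Free R) F ×
      ((∃ λ y′ → y′ ∈ C × y′ ≢ y) → ∃ λ e → E y e × Any (Edge y e) F)
  component-strands {C} {y} u lt r₀∉ y∈ conn att with remove y∈
  ... | [] , σ with a , c , r ← att {v = r₀} y∈ (λ { ≡.refl → r₀∉ y∈ })
      with ∈-resp-↭ σ (proj₁ (conn-target c))
  ...   | here ≡.refl = [ [ y ] ] , ↭-sym σ , (y , y , end y , r , r) ∷ [] ,
      λ { (y′ , i , n) → ⊥-elim (n (only (∈-resp-↭ σ i))) }
      where
      only : ∀ {x} → x ∈ y ∷ [] → x ≡ y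
      only (here e) = e
  component-strands {C} {y} u lt r₀∉ y∈ conn att | y′ ∷ _ , σ
    with (y≢y′ ∷ _) ∷ _ ← unique-↭ σ u
    -- Avoiding `y` makes `r₀`, `a` and `y` distinct, as the induction hypothesis demands.
    with a , c , r ← att {v = y} (∈-resp-↭ (↭-sym σ) (there (here ≡.refl))) (y≢y′ ∘ ≡.sym)
    with a∈ , a≢y ← conn-target c
    with z , T , e , f , p , π , g , h ← IH (Contract.G′ C r₀∉) lt (All.tabulate (λ { i ≡.refl → r₀∉ i }) ∷ u)
           (Contract.bic C r₀∉ conn att) (here ≡.refl) (there a∈) (there y∈)
           (λ { ≡.refl → r₀∉ a∈ }) (λ { ≡.refl → r₀∉ y∈ }) a≢y
    with s , F , q , t , at-q , fs , ≡.refl , edges ← Contract.cutup C r₀∉ p (All.tabulate (∈-resp-↭ (drop-∷ π))) r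
    with _ , ≡.refl ← path-start t =
    s ∷ F , drop-∷ π , (z , q , t , at-z f , at-q) ∷ fs , λ _ → e , E-ye , edges E-ye h
    where
    open Contract C r₀∉
    E-ye : E y e
    E-ye = inner y∈ (∈-resp-↭ (drop-∷ π) (edge-target h)) g
    at-z : ∀ {z} → E′ r₀ z → At R z
    at-z (inj₁ (i , _ , _)) = ⊥-elim (r₀∉ i)
    at-z (inj₂ (inj₁ (_ , _ , a))) = a
    at-z (inj₂ (inj₂ (_ , i , _))) = ⊥-elim (r₀∉ i)

  split-off : ∀ {U y} → Unique U → suc (length U) < n → r₀ ∉ U → y ∈ U → Attached U →
    ∃₂ λ C D → ∃ λ F → U ↭ C ++ D × y ∈ C × Apart C D × concat F ↭ C × All (Free R) F ×
      ((∃ λ y′ → y′ ∈ C × y′ ≢ y) → ∃ λ e → E y e × Any (Edge y e) F)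
  split-off {U} {y} u lt r₀∉ y∈ att
    with C , D , σ , y∈C , reach , apart ← component E? y∈
    with F , π , fs , slot ← component-strands (unique-++ˡ C (unique-↭ σ u))
           (ℕ.≤-<-trans (s≤s (ℕ.≤-trans (ℕ.m≤m+n _ _) (ℕ.≤-reflexive (≡.sym (≡.trans (↭-length σ) (length-++ C)))))) lt)
           (λ i → r₀∉ (∈-resp-↭ (↭-sym σ) (∈-++⁺ˡ i))) y∈C
           (λ i j → conn-trans (conn-sym (reach i)) (reach j)) (attached-part σ apart att) =
    C , D , F , σ , y∈C , apart , π , fs , slot

  concat-++ : ∀ F {H : List (List V)} {C D U} → U ↭ C ++ D → concat F ↭ C → concat H ↭ D → concat (F ++ H) ↭ U
  concat-++ F {H} σ π ρ = trans (↭-reflexive (≡.sym (List.concat-++ F H))) (trans (++⁺ π ρ) (↭-sym σ))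

  shorter : ∀ {U C D : List V} {y} → U ↭ C ++ D → y ∈ C → length D < length U
  shorter {D = D} σ i with B , τ ← remove i =
    ℕ.≤-trans (s≤s (ℕ.≤-trans (ℕ.m≤n+m (length D) (length B)) (ℕ.≤-reflexive (≡.sym (length-++ B)))))
      (ℕ.≤-reflexive (≡.sym (↭-length (trans σ (++⁺ʳ D τ)))))

  partition : ∀ k {U} → length U ≤ k → Unique U → suc (length U) < n → r₀ ∉ U → Attached U → Partition U
  partition k {[]} _ _ _ _ _ = [] , refl , []
  partition (suc k) {y ∷ U′} le u lt r₀∉ att
    with C , D , F , σ , y∈C , apart , π , fs , _ ← split-off u lt r₀∉ (here ≡.refl) att
    with H , ρ , hs ← partition k {D} (ℕ.≤-pred (ℕ.≤-trans (shorter σ y∈C) le)) (unique-++ʳ C (unique-↭ σ u))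
           (ℕ.<-trans (s≤s (shorter σ y∈C)) lt)
           (λ i → r₀∉ (∈-resp-↭ (↭-sym σ) (∈-++⁺ʳ C i)))
           (attached-part (trans σ (++-comm C D)) (apart-sym apart) att) =
    F ++ H , concat-++ F σ π ρ , All.++⁺ fs hs

  -- `y′` lies in the component of `y`, which thus has a second vertex and provides an edge at `y`.
  partition-slot : ∀ {U y y′} → Unique U → suc (length U) < n → r₀ ∉ U → Attached U →
    y ∈ U → y′ ∈ U → y′ ≢ y → E y y′ → Partition-slot U y
  partition-slot {U} {y} {y′} u lt r₀∉ att y∈ y′∈ n e
    with C , D , F , σ , y∈C , apart , π , fs , slot ← split-off u lt r₀∉ y∈ att
    with H , ρ , hs ← partition _ {D} ℕ.≤-refl (unique-++ʳ C (unique-↭ σ u))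
           (ℕ.≤-<-trans (s≤s (ℕ.≤-trans (ℕ.m≤n+m _ _) (ℕ.≤-reflexive (≡.sym (≡.trans (↭-length σ) (length-++ C)))))) lt)
           (λ i → r₀∉ (∈-resp-↭ (↭-sym σ) (∈-++⁺ʳ C i)))
           (attached-part (trans σ (++-comm C D)) (apart-sym apart) att)
    with ∈-++⁻ C (∈-resp-↭ σ y′∈)
  ... | inj₂ j = ⊥-elim (apart y∈C j e)
  ... | inj₁ j with d , g , h ← slot (y′ , j , n) =
    F ++ H , concat-++ F σ π ρ , All.++⁺ fs hs , d , g , Any.++⁺ˡ h

-- End blocks of the graph without `x₁`.

empty-or-inhabited : ∀ {V : Set} (L : List V) → L ≡ [] ⊎ ∃ λ m → m ∈ L
empty-or-inhabited []      = inj₁ ≡.refl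
empty-or-inhabited (m ∷ _) = inj₂ (m , here ≡.refl)

module Petals {V : Set} (_≟_ : DecidableEquality V) {n : ℕ} (IH : Hyp V n) (G : Rel V) where
  open Notions G
  open Chain _≟_ IH G
  open import Data.List.Membership.DecPropositional _≟_ using (_∈?_)

  module Around {A B : List V} {x₁ x₂ x₃ : V} (A≤n : length A ≤ n) (uA : Unique A) (bic : Bic A) (A↭ : A ↭ x₁ ∷ B)
           (x₂∈B : x₂ ∈ B) (x₃∈B : x₃ ∈ B) (x₂≢x₃ : x₂ ≢ x₃) where

    uB : Unique (x₁ ∷ B)
    uB = unique-↭ A↭ uA

    inA : ∀ {x} → x ∈ B → x ∈ A
    inA i = ∈-resp-↭ (↭-sym A↭) (there i)

    x₁∈A : x₁ ∈ A
    x₁∈A = ∈-resp-↭ (↭-sym A↭) (here ≡.refl)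

    ≢x₁ : ∀ {x} → x ∈ B → x ≢ x₁
    ≢x₁ i ≡.refl = unique-head uB i

    inB : ∀ {x} → x ∈ A ∖ x₁ → x ∈ B
    inB (i , n) = ∈-∷⁻ (∈-resp-↭ A↭ i) n

    connB : ∀ {u w} → u ∈ B → w ∈ B → Conn (_∈ B) u w
    connB i j = conn-map inB (proj₂ bic (inA i) (inA j) (≢x₁ i) (≢x₁ j))

    -- v separates U from x₂ and x₃ in G − x₁, and x₃ does not separate v from x₂.
    record Petal : Set where
      field
        v     : V
        U W   : List V
        perm  : B ↭ v ∷ U ++ W
        apart : Apart U W
        u₀    : V
        u₀∈U  : u₀ ∈ U
        x₂∈   : x₂ ∈ v ∷ W
        x₃∈   : x₃ ∈ W
        conn  : Conn (_∈ B ∖ x₃) v x₂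

    -- The set `v ∷ U` is an end block of `B`, attached to the rest at `v`.
    record Leaf : Set where
      field
        petal : Petal
      open Petal petal public
      field
        inside : ∀ {u w} → u ∈ U → w ∈ U → Conn (_∈ U) u w
        solid  : ∀ {p u} → p ∈ U → u ∈ v ∷ U → u ≢ p → Conn (_∈ v ∷ U ∖ p) u v

    module _ (P : Petal) where
      open Petal P

      leaveU : ∀ {a b} → a ∈ U → b ∈ B → E a b → b ∈ U ⊎ b ≡ v
      leaveU i j e with ∈-resp-↭ perm j
      ... | here p = inj₂ p
      ... | there k with ∈-++⁻ U k
      ...   | inj₁ l = inj₁ l
      ...   | inj₂ l = ⊥-elim (apart i l e)

      uP : Unique (v ∷ U ++ W)
      uP = unique-↭ perm (unique-++ʳ [ x₁ ] uB)

      U⊆B : ∀ {u} → u ∈ U → u ∈ B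
      U⊆B i = ∈-resp-↭ (↭-sym perm) (there (∈-++⁺ˡ i))

      v∈B : v ∈ B
      v∈B = ∈-resp-↭ (↭-sym perm) (here ≡.refl)

      v∉U : v ∉ U
      v∉U i = unique-head uP (∈-++⁺ˡ i)

      ∉U : ∀ {x} → x ∈ v ∷ W → x ∉ U
      ∉U (here ≡.refl) i = v∉U i
      ∉U (there j) i = unique-disjoint U (unique-++ʳ [ v ] uP) i j

      -- `B` is connected, and `U` can be left within `B` only through `v`.
      exit-at-v : ∀ {u} → u ∈ U → ∃ λ a → Conn (_∈ U) u a × E a v
      exit-at-v i with exit leaveU i (connB (U⊆B i) (∈-resp-↭ (↭-sym perm) (up x₂∈)))
        where
        up : ∀ {x} → x ∈ v ∷ W → x ∈ v ∷ U ++ W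
        up (here p)  = here p
        up (there j) = there (∈-++⁺ʳ U j)
      ... | inj₁ c = ⊥-elim (∉U x₂∈ (proj₂ (conn-target c)))
      ... | inj₂ (a , _ , c , e , _ , ≡.refl) = a , conn-map proj₂ c , e

    -- The part `D` cut off from `v` by `p` is a smaller petal; `p` reaches `v` inside `U`, hence
    -- without `x₃`.
    shrink : ∀ (P : Petal) {p C D} → p ∈ Petal.U P → Petal.v P ∷ Petal.U P ↭ p ∷ C ++ D → Petal.v P ∈ C → Apart C D →
             ∀ {d} → d ∈ D → Petal
    shrink P {p} {C} {D} p∈U σ v∈C CD d∈D = record
      { v = p ; U = D ; W = C ++ W
      ; perm = trans perm (trans (++⁺ʳ W σ) (prep p (trans (++⁺ʳ W (++-comm C D)) (↭-reflexive (++-assoc D C W)))))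
      ; apart = apart′ ; u₀ = _ ; u₀∈U = d∈D ; x₂∈ = up x₂∈ ; x₃∈ = ∈-++⁺ʳ C x₃∈
      ; conn = conn-trans (back (exit-at-v P p∈U)) conn }
      where
      open Petal P
      uσ : Unique (p ∷ C ++ D)
      uσ = unique-↭ σ (unique-++ˡ (v ∷ U) (uP P))
      D⊆U : ∀ {x} → x ∈ D → x ∈ U
      D⊆U i = ∈-∷⁻ (∈-resp-↭ (↭-sym σ) (there (∈-++⁺ʳ C i)))
        λ { ≡.refl → unique-disjoint C (unique-++ʳ [ p ] uσ) v∈C i }
      apart′ : Apart D (C ++ W)
      apart′ i j e with ∈-++⁻ C j
      ... | inj₁ k = CD k i (E-sym e)
      ... | inj₂ k = apart (D⊆U i) k e
      up : x₂ ∈ v ∷ W → x₂ ∈ p ∷ C ++ W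
      up (here ≡.refl) = there (∈-++⁺ˡ v∈C)
      up (there k)     = there (∈-++⁺ʳ C k)
      U∌x₃ : ∀ {x} → x ∈ U → x ≢ x₃
      U∌x₃ i ≡.refl = ∉U P (there x₃∈) i
      back : (∃ λ a → Conn (_∈ U) p a × E a v) → Conn (_∈ B ∖ x₃) p v
      back (a , c , e) = conn-snoc (conn-map (λ i → U⊆B P i , U∌x₃ i) c) e
        (v∈B P , λ { ≡.refl → unique-head (uP P) (∈-++⁺ʳ U x₃∈) })

    -- The petal is replaced by a component of `U`, or by a part that a vertex of `U` cuts off from
    -- `v`, until neither is smaller.
    minimal : ∀ k (P : Petal) → length (Petal.U P) ≤ k → Leaf
    minimal zero P le = ⊥-elim (ℕ.<⇒≱ (∈-length (Petal.u₀∈U P)) le)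
    minimal (suc k) P le with component E? (Petal.u₀∈U P)
    ... | C , d ∷ D , σ , u₀∈C , _ , CD = minimal k record
        { v = v ; U = C ; W = d ∷ D ++ W
        ; perm = trans perm (prep v (trans (++⁺ʳ W σ) (↭-reflexive (++-assoc C (d ∷ D) W))))
        ; apart = λ i j → case i (∈-++⁻ (d ∷ D) j) ; u₀ = u₀ ; u₀∈U = u₀∈C ; x₂∈ = up x₂∈ ; x₃∈ = there (∈-++⁺ʳ D x₃∈)
        ; conn = conn }
        (ℕ.≤-pred (ℕ.≤-trans (ℕ.≤-trans (ℕ.≤-reflexive (ℕ.+-comm 1 (length C))) (ℕ.+-monoʳ-≤ (length C) (s≤s z≤n)))
          (ℕ.≤-trans (ℕ.≤-reflexive (≡.sym (≡.trans (↭-length σ) (length-++ C)))) le)))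
      where
      open Petal P
      case : ∀ {x y} → x ∈ C → y ∈ d ∷ D ⊎ y ∈ W → ¬ E x y
      case i (inj₁ j) = CD i j
      case i (inj₂ j) = apart (∈-resp-↭ (↭-sym σ) (∈-++⁺ˡ i)) j
      up : x₂ ∈ v ∷ W → x₂ ∈ v ∷ d ∷ D ++ W
      up (here p)  = here p
      up (there j) = there (there (∈-++⁺ʳ D j))
    ... | C , [] , σ , u₀∈C , reach , _ with scan U at
      where
      open Petal P
      at : ∀ {p} → p ∈ U → (∀ {u} → u ∈ v ∷ U → u ≢ p → Conn (_∈ v ∷ U ∖ p) u v) ⊎ Leaf
      at {p} i with remove (there {x = v} i)
      ... | L , τ with component E? (∈-∷⁻ (∈-resp-↭ τ (here ≡.refl)) (λ { ≡.refl → v∉U P i }))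
      ...   | C , d ∷ D , ρ , v∈C , _ , CD = inj₂ (minimal k (shrink P i (trans τ (prep p ρ)) v∈C CD (here ≡.refl))
          (ℕ.≤-pred (ℕ.≤-trans (ℕ.≤-trans (ℕ.+-monoˡ-≤ (length (d ∷ D)) (∈-length v∈C)) (ℕ.≤-reflexive
            (≡.sym (≡.trans (ℕ.suc-injective (↭-length (trans τ (prep p ρ)))) (length-++ C))))) le)))
      ...   | C , [] , ρ , v∈C , reachv , _ = inj₁ λ j m → conn-sym (conn-map inv (reachv (in-C (∈-∷⁻ (∈-resp-↭ τ j) m))))
        where
        C≡ : L ↭ C
        C≡ = trans ρ (↭-reflexive (++-identityʳ C))
        in-C : ∀ {x} → x ∈ L → x ∈ C
        in-C = ∈-resp-↭ C≡
        inv : ∀ {x} → x ∈ C → x ∈ v ∷ U ∖ p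
        inv j = ∈-resp-↭ (↭-sym τ) (there (∈-resp-↭ (↭-sym C≡) j)) ,
          λ { ≡.refl → unique-head (unique-↭ τ (unique-++ˡ (v ∷ U) (uP P))) (∈-resp-↭ (↭-sym C≡) j) }
    ...   | inj₂ leaf = leaf
    ...   | inj₁ f = record { petal = P ; inside = λ i j → conn-map out (conn-trans (conn-sym (reach (into i))) (reach (into j))) ; solid = λ i → f i }
      where
      C≡ : Petal.U P ↭ C
      C≡ = trans σ (↭-reflexive (++-identityʳ C))
      into : ∀ {x} → x ∈ Petal.U P → x ∈ C
      into = ∈-resp-↭ C≡
      out : ∀ {x} → x ∈ C → x ∈ Petal.U P
      out = ∈-resp-↭ (↭-sym C≡)

    module WithoutPetal {K M : List V} (B↭ : B ↭ x₃ ∷ K ++ M) (x₂∈K : x₂ ∈ K)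
      (reachK : ∀ {x} → x ∈ K → Conn (_∈ K) x₂ x) (KM : Apart K M) where

      u₃ : Unique (x₃ ∷ K ++ M)
      u₃ = unique-↭ B↭ (unique-++ʳ [ x₁ ] uB)

      K⊆B : ∀ {x} → x ∈ K → x ∈ B
      K⊆B i = ∈-resp-↭ (↭-sym B↭) (there (∈-++⁺ˡ i))

      x₃∉K : x₃ ∉ K
      x₃∉K i = unique-head u₃ (∈-++⁺ˡ i)

      Reach : V → Set
      Reach v = ∀ {u} → u ∈ B → u ≢ v → Conn (_∈ B ∖ v) u x₂ ⊎ Conn (_∈ B ∖ v) u x₃

      -- The seeds are those of `x₂` and `x₃` that differ from `v`; whatever they fail to reach in
      -- `B` without `v` forms a petal.
      seeded : ∀ {v} S R → B ↭ v ∷ S ++ R → (∀ {s} → s ∈ S → s ≡ x₂ ⊎ s ≡ x₃) → x₂ ∈ v ∷ S → x₃ ∈ S → v ∈ K →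
               Reach v ⊎ Petal
      seeded {v} S R σ seeds i₂ i₃ v∈K with closure E? _ S R ℕ.≤-refl
      ... | C , d ∷ D , τ , inc , _ , CD = inj₂ record
        { v = v ; U = d ∷ D ; W = C ; perm = trans σ (prep v (trans τ (++-comm C (d ∷ D)))) ; apart = apart-sym CD
        ; u₀ = d ; u₀∈U = here ≡.refl ; x₂∈ = up i₂ ; x₃∈ = inc i₃
        ; conn = conn-sym (conn-map (λ i → K⊆B i , λ { ≡.refl → x₃∉K i }) (reachK v∈K)) }
        where
        up : x₂ ∈ v ∷ S → x₂ ∈ v ∷ C
        up (here p)  = here p
        up (there j) = there (inc j)
      ... | C , [] , τ , inc , reach , _ = inj₁ out
        where
        ρ : B ↭ v ∷ C
        ρ = trans σ (prep v (trans τ (↭-reflexive (++-identityʳ C))))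
        inC : ∀ {x} → x ∈ C → x ∈ B ∖ v
        inC i = ∈-resp-↭ (↭-sym ρ) (there i) , λ { ≡.refl → unique-head (unique-↭ ρ (unique-++ʳ [ x₁ ] uB)) i }
        out : Reach v
        out i m with s , j , c ← reach (∈-∷⁻ (∈-resp-↭ ρ i) m) with seeds j
        ... | inj₁ ≡.refl = inj₁ (conn-sym (conn-map inC c))
        ... | inj₂ ≡.refl = inj₂ (conn-sym (conn-map inC c))

      at : ∀ {v} → v ∈ K → Reach v ⊎ Petal
      at {v} i with v ≟ x₂ | remove (K⊆B i)
      ... | yes ≡.refl | L , σ with L′ , τ ← remove (∈-∷⁻ (∈-resp-↭ σ x₃∈B) (x₂≢x₃ ∘ ≡.sym)) =
        seeded [ x₃ ] L′ (trans σ (prep v τ)) (λ { (here p) → inj₂ p }) (here ≡.refl) (here ≡.refl) i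
      ... | no v≢x₂ | L , σ
        with L′ , τ ← third (∈-∷⁻ (∈-resp-↭ σ x₂∈B) (v≢x₂ ∘ ≡.sym)) (∈-∷⁻ (∈-resp-↭ σ x₃∈B) λ { ≡.refl → x₃∉K i }) x₂≢x₃ =
        seeded (x₂ ∷ x₃ ∷ []) L′ (trans σ (prep v τ)) (λ { (here p) → inj₁ p ; (there (here p)) → inj₂ p })
          (there (here ≡.refl)) (there (here ≡.refl)) i

      leaveK : ∀ {a b} → a ∈ K → b ∈ B → E a b → b ∈ K ⊎ b ≡ x₃
      leaveK i j e with ∈-resp-↭ B↭ j
      ... | here p = inj₂ p
      ... | there k with ∈-++⁻ K k
      ...   | inj₁ l = inj₁ l
      ...   | inj₂ l = ⊥-elim (KM i l e)

      -- `K` can be left within `B` only through `x₃`, so walks to `x₂` or `x₃` are cut there.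
      stK : (∀ {v} → v ∈ K → Reach v) → St (x₃ ∷ K) x₃ x₂
      stK f = record { s∈ = here ≡.refl ; t∈ = there x₂∈K ; s≢t = x₂≢x₃ ∘ ≡.sym ; conn = whole ; reach = part }
        where
        whole : Conn (_∈ x₃ ∷ K) x₃ x₂
        whole with exit leaveK x₂∈K (connB x₂∈B x₃∈B)
        ... | inj₁ c = ⊥-elim (x₃∉K (proj₂ (conn-target c)))
        ... | inj₂ (_ , _ , c , e , _ , ≡.refl) = conn-sym (conn-snoc (conn-map (there ∘ proj₂) c) e (here ≡.refl))
        part : ∀ {v u} → u ∈ x₃ ∷ K → u ≢ v → Conn (_∈ x₃ ∷ K ∖ v) u x₃ ⊎ Conn (_∈ x₃ ∷ K ∖ v) u x₂
        part (here ≡.refl) m = inj₁ (stop (here ≡.refl , m))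
        part {v} {u} (there i) m with v ∈? K
        ... | no v∉K = inj₂ (conn-sym (conn-map (λ j → there j , λ { ≡.refl → v∉K j }) (reachK i)))
        ... | yes v∈K = both (f v∈K (K⊆B i) m)
          where
          out : ∀ {r} → Conn (_∈ B ∖ v) u r → Conn (_∈ x₃ ∷ K ∖ v) u x₃ ⊎ (r ∈ K × Conn (_∈ x₃ ∷ K ∖ v) u r)
          out c with exit {P = _∈ B ∖ v} (λ i j → leaveK i (proj₁ j)) i c
          ... | inj₁ d = inj₂ (proj₂ (conn-target d) , conn-map (λ { ((_ , m) , l) → there l , m }) d)
          ... | inj₂ (_ , _ , d , e , (_ , m) , ≡.refl) =
            inj₁ (conn-snoc (conn-map (λ { ((_ , m) , l) → there l , m }) d) e (here ≡.refl , m))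
          both : Conn (_∈ B ∖ v) u x₂ ⊎ Conn (_∈ B ∖ v) u x₃ → Conn (_∈ x₃ ∷ K ∖ v) u x₃ ⊎ Conn (_∈ x₃ ∷ K ∖ v) u x₂
          both (inj₁ c) with out c
          ... | inj₁ d = inj₁ d
          ... | inj₂ (_ , d) = inj₂ d
          both (inj₂ c) with out c
          ... | inj₁ d = inj₁ d
          ... | inj₂ (j , _) = ⊥-elim (x₃∉K j)

      A↭K : A ↭ x₁ ∷ x₃ ∷ K ++ M
      A↭K = trans A↭ (prep x₁ B↭)

      -- Outside `M` only `x₁` and `x₃` have neighbours in `M`; as neither is a cut vertex of `A`,
      -- both can be reached.
      stM : ∀ {m} → m ∈ M → St (x₁ ∷ x₃ ∷ M) x₁ x₃
      stM {m} m∈M = record { s∈ = here ≡.refl ; t∈ = there (here ≡.refl) ; s≢t = x₁≢x₃ ; conn = whole ; reach = part }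
        where
        x₁≢x₃ : x₁ ≢ x₃
        x₁≢x₃ p = ≢x₁ x₃∈B (≡.sym p)
        M⊆B : ∀ {x} → x ∈ M → x ∈ B
        M⊆B i = ∈-resp-↭ (↭-sym B↭) (there (∈-++⁺ʳ K i))
        leaveM : ∀ {a b} → a ∈ M → b ∈ A → E a b → b ∈ M ⊎ (b ≡ x₁ ⊎ b ≡ x₃)
        leaveM i j e with ∈-resp-↭ A↭K j
        ... | here p = inj₂ (inj₁ p)
        ... | there (here p) = inj₂ (inj₂ p)
        ... | there (there k) with ∈-++⁻ K k
        ...   | inj₁ l = ⊥-elim (KM l i (E-sym e))
        ...   | inj₂ l = inj₁ l
        out : ∀ {v u r} → u ∈ M → r ∉ M → Conn (_∈ A ∖ v) u r →
              Conn (_∈ x₁ ∷ x₃ ∷ M ∖ v) u x₁ ⊎ Conn (_∈ x₁ ∷ x₃ ∷ M ∖ v) u x₃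
        out {v} i r∉ c with exit {P = _∈ A ∖ v} (λ i j → leaveM i (proj₁ j)) i c
        ... | inj₁ d = ⊥-elim (r∉ (proj₂ (conn-target d)))
        ... | inj₂ (_ , _ , d , e , (_ , m) , inj₁ ≡.refl) =
          inj₁ (conn-snoc (conn-map (λ { ((_ , m) , l) → there (there l) , m }) d) e (here ≡.refl , m))
        ... | inj₂ (_ , _ , d , e , (_ , m) , inj₂ ≡.refl) =
          inj₂ (conn-snoc (conn-map (λ { ((_ , m) , l) → there (there l) , m }) d) e (there (here ≡.refl) , m))
        part : ∀ {v u} → u ∈ x₁ ∷ x₃ ∷ M → u ≢ v →
               Conn (_∈ x₁ ∷ x₃ ∷ M ∖ v) u x₁ ⊎ Conn (_∈ x₁ ∷ x₃ ∷ M ∖ v) u x₃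
        part (here ≡.refl) m = inj₁ (stop (here ≡.refl , m))
        part (there (here ≡.refl)) m = inj₂ (stop (there (here ≡.refl) , m))
        part {v} (there (there i)) m with v ≟ x₁
        ... | yes ≡.refl = out i (λ j → unique-head u₃ (∈-++⁺ʳ K j)) (proj₂ bic (inA (M⊆B i)) (inA x₃∈B) m (≢x₁ x₃∈B))
        ... | no v≢x₁ = out i (λ j → unique-head uB (M⊆B j)) (proj₂ bic (inA (M⊆B i)) x₁∈A m (v≢x₁ ∘ ≡.sym))
        whole : Conn (_∈ x₁ ∷ x₃ ∷ M) x₁ x₃
        whole with part {x₃} (there (there m∈M)) (λ { ≡.refl → unique-head u₃ (∈-++⁺ʳ K m∈M) })
                 | part {x₁} (there (there m∈M)) (≢x₁ (M⊆B m∈M))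
        ... | inj₂ c | _ = ⊥-elim (proj₂ (conn-target c) ≡.refl)
        ... | inj₁ _ | inj₁ d = ⊥-elim (proj₂ (conn-target d) ≡.refl)
        ... | inj₁ c | inj₂ d = conn-trans (conn-sym (conn-map proj₁ c)) (conn-map proj₁ d)

      shortK : length (x₃ ∷ K) < n
      shortK = ℕ.≤-trans (ℕ.≤-trans (s≤s (s≤s (ℕ.≤-trans (ℕ.m≤m+n _ _) (ℕ.≤-reflexive (≡.sym (length-++ K))))))
        (ℕ.≤-reflexive (≡.sym (↭-length A↭K)))) A≤n

      shortM : length (x₁ ∷ x₃ ∷ M) < n
      shortM = ℕ.≤-trans (ℕ.≤-trans (s≤s (s≤s (ℕ.≤-trans (ℕ.+-monoˡ-≤ (length M) (∈-length x₂∈K))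
        (ℕ.≤-reflexive (≡.sym (length-++ K)))))) (ℕ.≤-reflexive (≡.sym (↭-length A↭K)))) A≤n

      uK : Unique (x₃ ∷ K)
      uK = unique-++ˡ (x₃ ∷ K) u₃

      uM : Unique (x₁ ∷ x₃ ∷ M)
      uM = unique-++ˡ (x₁ ∷ x₃ ∷ M) (unique-↭ (trans A↭K (prep x₁ (prep x₃ (++-comm K M)))) uA)

      through : First (x₁ ∷ x₃ ∷ M) x₁ x₃ → First (x₃ ∷ K) x₃ x₂ → Strong A x₁ x₂ x₃
      through (z , T , e , p , π) (z′ , T′ , e′ , p′ , π′) with _ , ≡.refl ← path-start p′ =
        z , T ++ T′ , z′ , e , path-++ p (inj₁ e′) p′ ,
        trans (++⁺ π (drop-∷ π′)) (trans (prep x₁ (prep x₃ (++-comm M K))) (↭-sym A↭K)) , e′ , edge-glue p fwd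

      direct : B ↭ x₃ ∷ K → (∃ λ z → E x₁ z × Slot (x₃ ∷ K) z x₂ x₃) → Strong A x₁ x₂ x₃
      direct σ (z , e , P , f , p , π , g , h) = z , P , f , e , p , trans (prep x₁ (trans π (↭-sym σ))) (↭-sym A↭) , g , h

      neighbour : ∃ λ z → z ∈ B × E x₁ z × z ≢ x₂
      neighbour with exit {I = _≡ x₁} {T = _∈ B} leave ≡.refl (proj₂ bic x₁∈A (inA x₃∈B) (≢x₁ x₂∈B ∘ ≡.sym) (x₂≢x₃ ∘ ≡.sym))
        where
        leave : ∀ {a b} → a ≡ x₁ → b ∈ A ∖ x₂ → E a b → b ≡ x₁ ⊎ b ∈ B
        leave _ (i , _) _ with ∈-resp-↭ A↭ i
        ... | here p  = inj₁ p
        ... | there j = inj₂ j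
      ... | inj₁ c = ⊥-elim (≢x₁ x₃∈B (proj₂ (conn-target c)))
      ... | inj₂ (_ , z , c , e , (_ , m) , i) with ≡.refl ← proj₂ (conn-target c) = z , i , e , m

      -- If `x₃` separates some `M` from `x₂`, the path crosses `M`, then `x₃`, then `K`. Otherwise
      -- it enters the chain `x₃ ∷ K` at a neighbour of `x₁`.
      conclude : (∀ {v} → v ∈ K → Reach v) → Strong A x₁ x₂ x₃
      conclude f with empty-or-inhabited M
      ... | inj₂ (m , m∈M) = through (chain-first _ ℕ.≤-refl shortM uM (stM m∈M)) (chain-first _ ℕ.≤-refl shortK uK (stK f))
      ... | inj₁ eq = direct σ (chain-from (E x₁) _ ℕ.≤-refl shortK uK (stK f) (near neighbour) cuts)
        where
        σ : B ↭ x₃ ∷ K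
        σ = trans B↭ (prep x₃ (↭-reflexive (≡.trans (cong (K ++_) eq) (++-identityʳ K))))
        near : (∃ λ z → z ∈ B × E x₁ z × z ≢ x₂) → ∃ λ z → z ∈ x₃ ∷ K × E x₁ z × z ≢ x₂
        near (z , i , e , m) = z , ∈-resp-↭ σ i , e , m
        -- `c` is not a cut vertex of `A`, so the side of `x₃` contains a neighbour of `x₁`.
        cuts : ∀ {c C D} → x₃ ∷ K ↭ c ∷ C ++ D → x₃ ∈ C → x₂ ∈ D → Apart C D → ∃ λ z → z ∈ C × E x₁ z
        cuts {c} {C} {D} τ i j CD with exit {I = _∈ C} {T = _≡ x₁} leave i
            (proj₂ bic (inA x₃∈B) x₁∈A (λ { ≡.refl → unique-head (unique-↭ τ uK) (∈-++⁺ˡ i) }) x₁≢c)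
          where
          x₁≢c : x₁ ≢ c
          x₁≢c p = ≢x₁ (∈-resp-↭ (↭-sym (trans σ τ)) (here ≡.refl)) (≡.sym p)
          leave : ∀ {a b} → a ∈ C → b ∈ A ∖ c → E a b → b ∈ C ⊎ b ≡ x₁
          leave k (l , m) e with ∈-resp-↭ (trans A↭ (prep x₁ (trans σ τ))) l
          ... | here p = inj₂ p
          ... | there (here p) = ⊥-elim (m p)
          ... | there (there q) with ∈-++⁻ C q
          ...   | inj₁ r = inj₁ r
          ...   | inj₂ r = ⊥-elim (CD k r e)
        ... | inj₁ c = ⊥-elim (unique-head uB (∈-resp-↭ (↭-sym (trans σ τ)) (there (∈-++⁺ˡ (proj₂ (conn-target c))))))
        ... | inj₂ (z , _ , c , e , _ , ≡.refl) = z , proj₂ (conn-target c) , E-sym e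

    leaf-or-done : Leaf ⊎ Strong A x₁ x₂ x₃
    leaf-or-done with L , σ ← remove x₃∈B
      with K , M , τ , x₂∈K , reachK , KM ← component E? (∈-∷⁻ (∈-resp-↭ σ x₂∈B) x₂≢x₃)
      with scan K (WithoutPetal.at (trans σ (prep x₃ τ)) x₂∈K reachK KM)
    ... | inj₁ f = inj₂ (WithoutPetal.conclude (trans σ (prep x₃ τ)) x₂∈K reachK KM (λ i → f i))
    ... | inj₂ P = inj₁ (minimal _ P ℕ.≤-refl)

-- Simple paths, insertion of a vertex and assembly.

module _ {V : Set} where

  edge-sym : ∀ {u v : V} {l} → Edge u v l → Edge v u l
  edge-sym fwd      = bwd
  edge-sym bwd      = fwd
  edge-sym (next e) = next (edge-sym e)

  path-target : ∀ {R : V → V → Set} {a b l} → Path R a b l → b ∈ l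
  path-target (end _) = here ≡.refl
  path-target (_ ∷ p) = there (path-target p)

  path-linked : ∀ {R : V → V → Set} {a b l} → Path R a b l → Linked R l
  path-linked (end _) = [-]
  path-linked (r ∷ end _) = r ∷ [-]
  path-linked (r ∷ p@(_ ∷ _)) = r ∷ path-linked p

  extract : ∀ {l L : List V} → Unique l → All (_∈ L) l → ∃ λ U → L ↭ l ++ U
  extract {[]} _ _ = _ , refl
  extract {x ∷ l} {L} u (i ∷ is) with L′ , σ ← remove i
    with U , τ ← extract {l} (unique-++ʳ [ x ] u) (All.tabulate λ j → ∈-∷⁻ (∈-resp-↭ σ (All.lookup is j))
           λ { ≡.refl → unique-head u j }) = U , trans σ (prep x τ)

  edge∈concat : ∀ {u v : V} {F} → Any (Edge u v) F → v ∈ concat F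
  edge∈concat {F = s ∷ F} (here e)  = ∈-++⁺ˡ (edge-target e)
  edge∈concat {F = s ∷ F} (there a) = ∈-++⁺ʳ s (edge∈concat a)

  loop-trivial : ∀ {R : V → V → Set} {a l} → Unique (a ∷ l) → Path R a a (a ∷ l) → l ≡ []
  loop-trivial u (end _) = ≡.refl
  loop-trivial u (_ ∷ p) = ⊥-elim (unique-head u (path-target p))

module SimplePaths {V : Set} (_≟_ : DecidableEquality V) (E : V → V → Set) (E-sym : ∀ {u v} → E u v → E v u) where
  open Connect E E-sym
  open import Data.List.Membership.DecPropositional _≟_ using (_∈?_)

  suffix : ∀ {P : V → Set} {u v w l} → u ∈ l → Path E v w l → Unique l → All P l →
           ∃ λ m → Path E u w m × Unique m × All P m
  suffix (here ≡.refl) (end _) u a = _ , end _ , u , a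
  suffix (here ≡.refl) (r ∷ p) u a = _ , r ∷ p , u , a
  suffix (there i) (_ ∷ p) (_ ∷ u) (_ ∷ a) = suffix i p u a

  simple : ∀ {P : V → Set} {u w} → Conn P u w → ∃ λ l → Path E u w l × Unique l × All P l
  simple (stop p) = _ , end _ , [] ∷ [] , p ∷ []
  simple {u = u} (step p e c) with l , q , v , a ← simple c with u ∈? l
  ... | yes i = suffix i q v a
  ... | no ∄ = u ∷ l , e ∷ q , All.tabulate (λ { j ≡.refl → ∄ j }) ∷ v , p ∷ a

  path-conn : ∀ {s t a l} → Path E s t l → a ∈ l → Conn (_∈ l) s a
  path-conn (end _) (here ≡.refl) = stop (here ≡.refl)
  path-conn (_ ∷ _) (here ≡.refl) = stop (here ≡.refl)
  path-conn (e ∷ p) (there i) = step (here ≡.refl) e (conn-map there (path-conn p i))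

  -- Deleting `v` leaves at most two segments, each retaining an end of the path.
  path-ends : ∀ {s t a v l} → Path E s t l → Unique l → a ∈ l → a ≢ v → Conn (_∈ l ∖ v) a s ⊎ Conn (_∈ l ∖ v) a t
  path-ends (end _) u (here ≡.refl) m = inj₁ (stop (here ≡.refl , m))
  path-ends (_ ∷ _) u (here ≡.refl) m = inj₁ (stop (here ≡.refl , m))
  path-ends {s} {v = v} (e ∷ p) u@(_ ∷ u′) (there i) m with path-ends p u′ i m | s ≟ v
  ... | inj₂ c | _ = inj₂ (conn-map (λ { (j , k) → there j , k }) c)
  ... | inj₁ c | no s≢v = inj₁ (conn-snoc (conn-map (λ { (j , k) → there j , k }) c) (E-sym e) (here ≡.refl , s≢v))
  ... | inj₁ _ | yes ≡.refl = inj₂ (conn-map (λ j → there j , λ { ≡.refl → unique-head u j })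
    (conn-trans (conn-sym (path-conn p i)) (path-conn p (path-target p))))

module Assembly {V : Set} (G : Rel V) where
  open Notions G

  concat-conf : ∀ X Y F Q → concat (conf X Y F Q) ≡ X ++ Y ++ Q ++ concat F
  concat-conf X Y F Q = cong (λ l → X ++ Y ++ l) (≡.trans (≡.sym (List.concat-++ (map [_] Q) F))
    (cong (_++ concat F) (List.concat-map-[_] Q)))

  in-F : ∀ {P : List V → Set} {X Y F} Q → Any P F → Any P (conf X Y F Q)
  in-F Q a = there (there (Any.++⁺ʳ (map [_] Q) a))

  first-edge : ∀ {x z y T} → Unique (x ∷ T) → Edge x z (x ∷ T) → Path N² x y (x ∷ T) → Path N² z y T
  first-edge u fwd (r ∷ p) with _ , ≡.refl ← path-start p = p
  first-edge u bwd p = ⊥-elim (unique-head u (here ≡.refl))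
  first-edge u (next e) p = ⊥-elim (unique-head u (edge-source e))

  tail-edge : ∀ {x y e : V} {T} → y ≢ x → e ≢ x → Edge y e (x ∷ T) → Edge y e T
  tail-edge m n fwd      = ⊥-elim (m ≡.refl)
  tail-edge m n bwd      = ⊥-elim (n ≡.refl)
  tail-edge m n (next e) = e

  -- `x` goes between `y` and `e`: it is adjacent to `y` and reaches `e` through `y`.
  insert : ∀ {a b x y e T} → Path N² a b T → E y e → E y x → Edge y e T →
    ∃ λ T′ → Path N² a b T′ × T′ ↭ x ∷ T × Edge x y T′
  insert {x = x} (r ∷ p) ye yx fwd with _ , ≡.refl ← path-start p =
    _ , inj₁ yx ∷ via _ (E-sym yx) (E-sym ye) ∷ p , swap _ x refl , bwd
  insert {x = x} (r ∷ p) ye yx bwd with _ , ≡.refl ← path-start p =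
    _ , via _ (E-sym ye) (E-sym yx) ∷ inj₁ (E-sym yx) ∷ p , swap _ x refl , next fwd
  insert {a} {x = x} (r ∷ p) ye yx (next e) with T′ , p′ , π , e′ ← insert p ye yx e =
    a ∷ T′ , r ∷ p′ , trans (prep a π) (swap a x refl) , next e′

  assemble : ∀ {A x y w S z e} → Unique A → w ≢ x → Linkable x y S → concat S ↭ A →
    E x z → Any (Edge x z) S → E w e → e ≢ x → Any (Edge w e) S → Strong A x y w
  assemble u w≢x (P , p , π , edges) σ f i g n j with T , ≡.refl ← path-start p =
    _ , T , _ , f , first-edge (unique-↭ (↭-sym (trans π σ)) u) (edges i) p , trans π σ , g , tail-edge w≢x n (edges j)

-- The case of an end block.

module WithLeaf {V : Set} (_≟_ : DecidableEquality V) {n : ℕ} (IH : Hyp V n) (G : Rel V) where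
  open Notions G
  open Chain _≟_ IH G
  open Assembly G
  open SimplePaths _≟_ E E-sym
  open import Data.List.Membership.DecPropositional _≟_ using (_∈?_)

  module _ {A B : List V} {x₁ x₂ x₃ : V} (A≤n : length A ≤ n) (uA : Unique A) (bic : Bic A) (A↭ : A ↭ x₁ ∷ B)
           (x₂∈B : x₂ ∈ B) (x₃∈B : x₃ ∈ B) (x₂≢x₃ : x₂ ≢ x₃)
           (leaf : Petals.Around.Leaf _≟_ IH G A≤n uA bic A↭ x₂∈B x₃∈B x₂≢x₃) where

    open Petals.Around _≟_ IH G A≤n uA bic A↭ x₂∈B x₃∈B x₂≢x₃
    open Leaf leaf renaming (v to w; U to Z)

    A↭Z : A ↭ x₁ ∷ w ∷ Z ++ W
    A↭Z = trans A↭ (prep x₁ perm)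

    Z⊆A : ∀ {x} → x ∈ Z → x ∈ A
    Z⊆A i = inA (U⊆B petal i)

    stZ : ∀ {e} → e ∈ Z → St (w ∷ Z) w e
    stZ {e} i = record { s∈ = here ≡.refl ; t∈ = there i ; s≢t = λ { ≡.refl → v∉U petal i }
      ; conn = whole (exit-at-v petal i) ; reach = part }
      where
      whole : (∃ λ a → Conn (_∈ Z) e a × E a w) → Conn (_∈ w ∷ Z) w e
      whole (a , c , f) = conn-sym (conn-snoc (conn-map there c) f (here ≡.refl))
      part : ∀ {p u} → u ∈ w ∷ Z → u ≢ p → Conn (_∈ w ∷ Z ∖ p) u w ⊎ Conn (_∈ w ∷ Z ∖ p) u e
      part {p} j m with p ∈? Z
      ... | yes k = inj₁ (solid k j m)
      part {p} (here ≡.refl) m | no _ = inj₁ (stop (here ≡.refl , m))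
      part {p} (there j) m | no ∄ = inj₂ (conn-map (λ k → there k , λ { ≡.refl → ∄ k }) (inside j i))

    shortZ : length (w ∷ Z) < n
    shortZ = ℕ.≤-trans (ℕ.≤-trans (s≤s (s≤s (List.length-++-≤ˡ Z))) (ℕ.≤-reflexive (≡.sym (↭-length A↭Z)))) A≤n

    -- The block is traversed from `w`; dropping `w` leaves a strand whose first end is attached to
    -- `w`.
    strandZ : ∀ {e} → e ∈ Z → ∃₂ λ t T → E w t × Path N² t e T × T ↭ Z
    strandZ i with t , T , e , p , π ← chain-first _ ℕ.≤-refl shortZ (unique-++ˡ (w ∷ Z) (uP petal)) (stZ i) =
      t , T , e , p , drop-∷ π

    -- `w` is not a cut vertex of `A`, so `Z` can also be left through `x₁`.
    x₁-neighbour : ∃ λ z → z ∈ Z × E z x₁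
    x₁-neighbour with exit {I = _∈ Z} {T = _≡ x₁} leave u₀∈U
        (proj₂ bic (Z⊆A u₀∈U) x₁∈A (λ { ≡.refl → v∉U petal u₀∈U }) (≢x₁ (v∈B petal) ∘ ≡.sym))
      where
      leave : ∀ {a b} → a ∈ Z → b ∈ A ∖ w → E a b → b ∈ Z ⊎ b ≡ x₁
      leave i (j , m) e with ∈-resp-↭ A↭ j
      ... | here p = inj₂ p
      ... | there k with leaveU petal i k e
      ...   | inj₁ l = inj₁ l
      ...   | inj₂ p = ⊥-elim (m p)
    ... | inj₁ c = ⊥-elim (unique-head uB (U⊆B petal (proj₂ (conn-target c))))
    ... | inj₂ (z , _ , c , e , _ , ≡.refl) = z , proj₂ (conn-target c) , e

    -- Cut at its first visit to `w`, the walk never enters `Z`. It provides the path for the sweep.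
    outer : Conn (λ x → x ∈ w ∷ W × x ≢ x₃) x₂ w
    outer = go x₂∈
      where
      leave : ∀ {a b} → a ∈ W → b ∈ B ∖ x₃ → E a b → b ∈ W ⊎ b ≡ w
      leave i (j , _) e with ∈-resp-↭ perm j
      ... | here p = inj₂ p
      ... | there k with ∈-++⁻ Z k
      ...   | inj₁ l = ⊥-elim (apart l i (E-sym e))
      ...   | inj₂ l = inj₁ l
      w≢x₃ : w ≢ x₃
      w≢x₃ = proj₂ (conn-source conn)
      go : x₂ ∈ w ∷ W → Conn (λ x → x ∈ w ∷ W × x ≢ x₃) x₂ w
      go (here ≡.refl) = stop (here ≡.refl , w≢x₃)
      go (there i) with exit {I = _∈ W} {T = _≡ w} leave i (conn-sym conn)
      ... | inj₁ c = ⊥-elim (unique-head (uP petal) (∈-++⁺ʳ Z (proj₂ (conn-target c))))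
      ... | inj₂ (_ , _ , c , e , _ , ≡.refl) =
        conn-snoc (conn-map (λ { ((_ , m) , j) → there j , m }) c) e (here ≡.refl , w≢x₃)

    module WithPath {Q° U : List V} (pathQ : Path E x₂ w (x₂ ∷ Q°)) (W↭ : w ∷ W ↭ (x₂ ∷ Q°) ++ U)
                    (x₃∉Q : x₃ ∉ x₂ ∷ Q°) where

      Q : List V
      Q = x₂ ∷ Q°

      x₃∈U : x₃ ∈ U
      x₃∈U with ∈-++⁻ Q (∈-resp-↭ W↭ (there x₃∈))
      ... | inj₁ i = ⊥-elim (x₃∉Q i)
      ... | inj₂ i = i

      uW : Unique (Q ++ U)
      uW = unique-↭ W↭ (unique-++ˡ (w ∷ W) (unique-↭ (trans perm (prep w (++-comm Z W))) (unique-++ʳ [ x₁ ] uB)))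

      w∈Q : w ∈ Q
      w∈Q = path-target pathQ

      U⊆W : ∀ {x} → x ∈ U → x ∈ W
      U⊆W i = ∈-∷⁻ (∈-resp-↭ (↭-sym W↭) (∈-++⁺ʳ Q i)) λ { ≡.refl → unique-disjoint Q uW w∈Q i }

      ZU : Apart Z U
      ZU i j = apart i (U⊆W j)

      A↭Q : A ↭ x₁ ∷ Z ++ Q ++ U
      A↭Q = trans A↭Z (prep x₁ (trans (↭-sym (shift w Z W)) (++⁺ˡ Z W↭)))

      U⊆B′ : ∀ {x} → x ∈ U → x ∈ B
      U⊆B′ i = ∈-resp-↭ (↭-sym perm) (there (∈-++⁺ʳ Z (U⊆W i)))

      open Strands _≟_ IH G (x₁ ∷ Q) x₁ public

      -- `Z` has no edges to `U`, so a walk leaving `U′` enters `x₁ ∷ Q`. The target is `x₂` if `v`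
      -- is `x₁`, and `x₁` otherwise.
      attached : ∀ {U′} → (∀ {x} → x ∈ U′ → x ∈ U) → (∀ {a b} → a ∈ U′ → b ∈ U → E a b → b ∈ U′) → Attached U′
      attached {U′} sub closed {v} {u} i m = choose (v ≟ x₁)
        where
        leave : ∀ {a b} → a ∈ U′ → E a b → b ∈ x₁ ∷ Z ++ Q ++ U → b ∈ U′ ⊎ b ∈ x₁ ∷ Q
        leave j e (here p) = inj₂ (here p)
        leave j e (there k) with ∈-++⁻ Z k
        ... | inj₁ l = ⊥-elim (ZU l (sub j) (E-sym e))
        ... | inj₂ l with ∈-++⁻ Q l
        ...   | inj₁ q = inj₂ (there q)
        ...   | inj₂ q = inj₁ (closed j q e)
        out : ∀ {r} → r ∉ U′ → Conn (_∈ A ∖ v) u r → ∃ λ a → Conn (_∈ U′ ∖ v) u a × At (x₁ ∷ Q) a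
        out r∉ c with exit {P = _∈ A ∖ v} (λ { j (k , _) e → leave j e (∈-resp-↭ A↭Q k) }) i c
        ... | inj₁ d = ⊥-elim (r∉ (proj₂ (conn-target d)))
        ... | inj₂ (a , _ , d , e , _ , t) = a , conn-map (λ { ((_ , m) , l) → l , m }) d , Any.map (λ { ≡.refl → e }) t
        choose : Dec (v ≡ x₁) → ∃ λ a → Conn (_∈ U′ ∖ v) u a × At (x₁ ∷ Q) a
        choose (yes ≡.refl) = out (λ j → unique-disjoint Q uW (here ≡.refl) (sub j))
          (proj₂ bic (inA (U⊆B′ (sub i))) (inA x₂∈B) m (≢x₁ x₂∈B))
        choose (no v≢x₁) = out (λ j → unique-head uB (U⊆B′ (sub j)))
          (proj₂ bic (inA (U⊆B′ (sub i))) x₁∈A m (v≢x₁ ∘ ≡.sym))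

      short : suc (length U) < n
      short = ℕ.≤-trans (ℕ.≤-trans (s≤s (ℕ.≤-trans (s≤s (List.length-++-≤ʳ U {Q°})) (List.length-++-≤ʳ (Q ++ U) {Z})))
        (ℕ.≤-reflexive (≡.sym (↭-length A↭Q)))) A≤n

      atQ : ∀ {t} → E w t → At Q t
      atQ e = Any.map (λ { ≡.refl → E-sym e }) w∈Q

      x₁∉U : x₁ ∉ U
      x₁∉U i = unique-head uB (U⊆B′ i)

      uU : Unique U
      uU = unique-++ʳ Q uW

      linkedQ : Linked E Q
      linkedQ = path-linked pathQ

      linkedQ° : Linked E Q°
      linkedQ° = go linkedQ
        where
        go : ∀ {q Q} → Linked E (q ∷ Q) → Linked E Q
        go [-]     = []
        go (_ ∷ l) = l

      open ↭-Solver {V} using (_⊕_; _⊜_)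

      regroup : ∀ {T Uᵣ} → T ↭ Z → Uᵣ ↭ U → x₁ ∷ T ++ Q ++ Uᵣ ↭ A
      regroup π ρ = trans (prep x₁ (++⁺ π (++⁺ˡ Q ρ))) (↭-sym A↭Q)

      -- At most one strand is left at `x₁` after pairing. If its other end is on `Q`, it starts the
      -- path and `Z` is a free strand with both ends at `w`; in the other cases `Z` leads from `x₁`
      -- to `w`.
      spread : ∀ {y} → y ∈ U → y ≢ x₃ → E x₃ y → Strong A x₁ x₂ x₃
      spread {y} y∈U y≢x₃ x₃y
        with F , π , fs , e , x₃e , slot ← partition-slot uU short x₁∉U (attached id (λ _ j _ → j)) x₃∈U y∈U y≢x₃ x₃y
        with z , z∈Z , zx₁ ← x₁-neighbour
        with t , T , wt , p , ρ ← strandZ z∈Z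
        with l , l∈Z , lw ← exit-at-v petal u₀∈U
        with t′ , T′ , wt′ , p′ , ρ′ ← strandZ (conn-target l∈Z)
        = finish (Locate.resolve x₁ Q _ ℕ.≤-refl fs)
        where
        e≢x₁ : e ≢ x₁
        e≢x₁ ≡.refl = x₁∉U (∈-resp-↭ π (edge∈concat slot))
        x₃≢x₁ : x₃ ≢ x₁
        x₃≢x₁ = ≢x₁ x₃∈B
        -- `x₂` is already in use as the last vertex, so the sweep starts in the middle of the step
        -- at `x₂`.
        link : ∀ {a X H} → Path N² a x₁ X → At Q a → All (Free Q) H → Linkable x₁ x₂ (conf X [ x₂ ] H Q°)
        link q at hs = swapXY Q° (Step.mid x₂ Q° linkedQ (solve Q° linkedQ°) _ ℕ.≤-refl (end x₂) q at hs)
        finish : Locate.Resolved x₁ Q F → Strong A x₁ x₂ x₃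
        finish (inj₁ (H , hs , ref , sub)) =
          assemble uA x₃≢x₁ (link (path-++ p (inj₁ zx₁) (end x₁)) (atQ wt) hs)
            (trans (↭-reflexive (concat-conf (T ++ [ x₁ ]) [ x₂ ] H Q°))
              (trans (solve₄ T [ x₁ ] Q (concat H)) (regroup ρ (trans ref π))))
            (E-sym zx₁) (here (edge-sym (edge-glue p fwd))) x₃e e≢x₁ (in-F Q° (sub slot))
          where
          solve₄ : ∀ a b c d → (a ++ b) ++ c ++ d ↭ b ++ a ++ c ++ d
          solve₄ = ↭-Solver.solve 4
            (λ a b c d → (a ⊕ b) ⊕ c ⊕ d ⊜ b ⊕ a ⊕ c ⊕ d) refl
        finish (inj₂ (s , H , (a , b , q , ea , at) , hs , ref , sub)) with Locate.split x₁ Q at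
        -- `Z` is joined to the far end of the strand by jumping over `x₁`; the first edge leads
        -- into the strand.
        ... | inj₁ eb =
          assemble uA x₃≢x₁
            (link (path-++ p (via x₁ zx₁ eb) (path-++ (path-reverse N²-sym q) (inj₁ ea) (end x₁))) (atQ wt) hs)
            (trans (↭-reflexive (concat-conf (T ++ reverse s ++ [ x₁ ]) [ x₂ ] H Q°))
              (trans (solve₅ T (reverse s) [ x₁ ] Q (concat H))
                (regroup ρ (trans (++⁺ʳ (concat H) (↭-reverse s)) (trans ref π)))))
            (E-sym ea) (here (edge-++ʳ T (edge-sym (edge-glue (path-reverse N²-sym q) fwd)))) x₃e e≢x₁ (place (sub slot))
          where
          solve₅ : ∀ t s x q h → (t ++ s ++ x) ++ q ++ h ↭ x ++ t ++ q ++ s ++ h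
          solve₅ = ↭-Solver.solve 5
            (λ t s x q h → (t ⊕ s ⊕ x) ⊕ q ⊕ h ⊜ x ⊕ t ⊕ q ⊕ s ⊕ h) refl
          place : ∀ {u v Y} → Any (Edge u v) (s ∷ H) → Any (Edge u v) (conf (T ++ reverse s ++ [ x₁ ]) Y H Q°)
          place (here g)  = here (edge-++ʳ T (edge-++ˡ [ x₁ ] (edge-reverse g)))
          place (there i) = in-F Q° i
        ... | inj₂ at-b =
          assemble uA x₃≢x₁
            (link (path-++ (path-reverse N²-sym q) (inj₁ ea) (end x₁)) at-b
              ((t′ , l , p′ , atQ wt′ , atQ (E-sym lw)) ∷ hs))
            (trans (↭-reflexive (concat-conf (reverse s ++ [ x₁ ]) [ x₂ ] (T′ ∷ H) Q°))
              (trans (solve₅ T′ (reverse s) [ x₁ ] Q (concat H))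
                (regroup ρ′ (trans (++⁺ʳ (concat H) (↭-reverse s)) (trans ref π)))))
            (E-sym ea) (here (edge-sym (edge-glue (path-reverse N²-sym q) fwd))) x₃e e≢x₁ (place (sub slot))
          where
          solve₅ : ∀ t s x q h → (s ++ x) ++ q ++ t ++ h ↭ x ++ t ++ q ++ s ++ h
          solve₅ = ↭-Solver.solve 5
            (λ t s x q h → (s ⊕ x) ⊕ q ⊕ t ⊕ h ⊜ x ⊕ t ⊕ q ⊕ s ⊕ h) refl
          place : ∀ {u v Y} → Any (Edge u v) (s ∷ H) → Any (Edge u v) (conf (reverse s ++ [ x₁ ]) Y (T′ ∷ H) Q°)
          place (here g)  = here (edge-++ˡ [ x₁ ] (edge-reverse g))
          place (there i) = in-F Q° (there i)

      module Tight (tight : ∀ {y} → y ∈ A → E x₃ y → y ≢ x₃ → y ∈ Q ⊎ y ≡ x₁) {H : List V} (A↭H : A ↭ x₃ ∷ H) where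

        uH : Unique (x₃ ∷ H)
        uH = unique-↭ A↭H uA

        inH : ∀ {x} → x ∈ A → x ≢ x₃ → x ∈ H
        inH i = ∈-∷⁻ (∈-resp-↭ A↭H i)

        x₁∈H : x₁ ∈ H
        x₁∈H = inH x₁∈A (≢x₁ x₃∈B ∘ ≡.sym)

        x₂∈H : x₂ ∈ H
        x₂∈H = inH (inA x₂∈B) x₂≢x₃

        Q⊆H : ∀ {x} → x ∈ Q → x ∈ H
        Q⊆H i = inH (∈-resp-↭ (↭-sym A↭Q) (there (∈-++⁺ʳ Z (∈-++⁺ˡ i)))) λ { ≡.refl → x₃∉Q i }

        Z⊆H : ∀ {x} → x ∈ Z → x ∈ H
        Z⊆H i = inH (Z⊆A i) λ { ≡.refl → ∉U petal (there x₃∈) i }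

        uQ : Unique Q
        uQ = unique-++ˡ Q uW

        uAQ : Unique (x₁ ∷ Z ++ Q ++ U)
        uAQ = unique-↭ A↭Q uA

        -- The walk follows `Q`; if this leads to `w` instead of `x₂`, it continues through `Z` to
        -- `x₁`.
        ends : ∀ {v a} → a ∈ Q → a ≢ v → Conn (_∈ H ∖ v) a x₁ ⊎ Conn (_∈ H ∖ v) a x₂
        ends {v} {a} i m with v ∈? Q
        ... | no ∄ = inj₂ (conn-map (λ j → Q⊆H j , λ { ≡.refl → ∄ j }) (conn-sym (path-conn pathQ i)))
        ... | yes v∈Q with path-ends pathQ uQ i m
        ...   | inj₁ c = inj₂ (conn-map (λ { (j , k) → Q⊆H j , k }) c)
        ...   | inj₂ c with z , z∈Z , zx₁ ← x₁-neighbour with l , d , lw ← exit-at-v petal z∈Z =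
          inj₁ (conn-snoc (conn-trans (conn-map (λ { (j , k) → Q⊆H j , k }) c)
            (step (Q⊆H w∈Q , proj₂ (conn-target c)) (E-sym lw) (conn-sym (conn-map (λ j → Z⊆H j , Z≢v j) d)))) zx₁
            (x₁∈H , λ { ≡.refl → unique-head uAQ (∈-++⁺ʳ Z (∈-++⁺ˡ v∈Q)) }))
          where
          Z≢v : ∀ {x} → x ∈ Z → x ≢ v
          Z≢v j ≡.refl = unique-disjoint Z (unique-++ʳ [ x₁ ] uAQ) j (∈-++⁺ˡ v∈Q)

        -- A walk in `A` enters `x₃` from `x₁` or from a vertex of `Q`, and is diverted there by
        -- `ends`.
        stH : St H x₁ x₂
        stH = record { s∈ = x₁∈H ; t∈ = x₂∈H ; s≢t = ≢x₁ x₂∈B ∘ ≡.sym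
          ; conn = conn-map (λ { (i , m) → inH i m }) (proj₂ bic x₁∈A (inA x₂∈B) (≢x₁ x₃∈B ∘ ≡.sym) x₂≢x₃)
          ; reach = part }
          where
          part : ∀ {v u} → u ∈ H → u ≢ v → Conn (_∈ H ∖ v) u x₁ ⊎ Conn (_∈ H ∖ v) u x₂
          part {v} {u} i m = choose (v ≟ x₁)
            where
            u∈A : u ∈ A
            u∈A = ∈-resp-↭ (↭-sym A↭H) (there i)
            leave : ∀ {a b} → a ≢ x₃ → b ∈ A ∖ v → E a b → b ≢ x₃ ⊎ b ≡ x₃
            leave {b = b} _ _ _ with b ≟ x₃
            ... | yes p = inj₂ p
            ... | no p  = inj₁ p
            out : ∀ {r} → Conn (_∈ A ∖ v) u r →
                  (Conn (_∈ H ∖ v) u x₁ ⊎ Conn (_∈ H ∖ v) u x₂) ⊎ Conn (_∈ H ∖ v) u r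
            out c with exit leave (λ { ≡.refl → unique-head uH i }) c
            ... | inj₁ d = inj₂ (conn-map (λ { ((j , k) , l) → inH j l , k }) d)
            ... | inj₂ (a , _ , d , e , _ , ≡.refl) with conn-target d
            ...   | ((j , k) , l) with tight j (E-sym e) l
            ...     | inj₂ ≡.refl = inj₁ (inj₁ (conn-map (λ { ((j , k) , l) → inH j l , k }) d))
            ...     | inj₁ q with ends q k
            ...       | inj₁ f = inj₁ (inj₁ (conn-trans (conn-map (λ { ((j , k) , l) → inH j l , k }) d) f))
            ...       | inj₂ f = inj₁ (inj₂ (conn-trans (conn-map (λ { ((j , k) , l) → inH j l , k }) d) f))
            choose : Dec (v ≡ x₁) → Conn (_∈ H ∖ v) u x₁ ⊎ Conn (_∈ H ∖ v) u x₂
            choose (yes ≡.refl) with out (proj₂ bic u∈A (inA x₂∈B) m (≢x₁ x₂∈B))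
            ... | inj₁ r = r
            ... | inj₂ r = inj₂ r
            choose (no v≢x₁) with out (proj₂ bic u∈A x₁∈A m (v≢x₁ ∘ ≡.sym))
            ... | inj₁ r = r
            ... | inj₂ r = inj₁ r

        shortH : length H < n
        shortH = ℕ.≤-trans (ℕ.≤-reflexive (≡.sym (↭-length A↭H))) A≤n

        -- `c` is not a cut vertex of `A`, so `D` contains a neighbour of `x₃`. Inserting `x₃` in
        -- the half `D` leaves the first edge, in the half `C`, intact.
        insert-cut : Cut H x₁ x₂ → Strong A x₁ x₂ x₃
        insert-cut cut = combine (chain-first _ ℕ.≤-refl shortL (unique-left (Cut.perm cut) uH′) (Cut.left cut)) second
          where
          open Cut cut renaming (perm to permH; apart to CD)
          uH′ : Unique H
          uH′ = unique-++ʳ [ x₃ ] uH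
          lenH : length H ≡ suc (length (C ++ D))
          lenH = ↭-length permH
          shortL : length (c ∷ C) < n
          shortL = ℕ.≤-<-trans (ℕ.≤-trans (s≤s (List.length-++-≤ˡ C)) (ℕ.≤-reflexive (≡.sym lenH))) shortH
          shortR : length (c ∷ D) < n
          shortR = ℕ.≤-<-trans (ℕ.≤-trans (s≤s (List.length-++-≤ʳ D {C})) (ℕ.≤-reflexive (≡.sym lenH))) shortH
          uR : Unique (c ∷ D)
          uR = unique-left perm′ uH′
          c≢ : ∀ {x} → x ∈ C ++ D → x ≢ c
          c≢ i ≡.refl = unique-head (unique-↭ permH uH′) i
          leave : ∀ {a b} → a ∈ D → b ∈ A ∖ c → E a b → b ∈ D ⊎ b ≡ x₃
          leave i (j , m) e with ∈-resp-↭ (trans A↭H (prep x₃ permH)) j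
          ... | here p = inj₂ p
          ... | there (here p) = ⊥-elim (m p)
          ... | there (there k) with ∈-++⁻ C k
          ...   | inj₁ l = ⊥-elim (CD l i (E-sym e))
          ...   | inj₂ l = inj₁ l
          y-exists : ∃ λ y → y ∈ D × E y x₃
          y-exists with exit leave t∈D (proj₂ bic (inA x₂∈B) x₁∈A (c≢ (∈-++⁺ʳ C t∈D)) (c≢ (∈-++⁺ˡ s∈C)))
          ... | inj₁ d = ⊥-elim (unique-disjoint C (unique-++ʳ [ c ] (unique-↭ permH uH′)) s∈C (proj₂ (conn-target d)))
          ... | inj₂ (y , _ , d , e , _ , ≡.refl) = y , proj₂ (conn-target d) , e
          slotted : ∃ λ y → E y x₃ × Slot (c ∷ D) c x₂ y
          slotted with y , y∈D , yx₃ ← y-exists with y ≟ x₂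
          ... | no y≢x₂ = y , yx₃ , chain-slot _ ℕ.≤-refl shortR uR right (there y∈D) (c≢ (∈-++⁺ʳ C y∈D)) y≢x₂
          -- An edge at the last vertex `x₂` is obtained by traversing the right half backwards.
          ... | yes ≡.refl with z , T , e , p , π ← chain-first _ ℕ.≤-refl shortR uR (St-sym right)
                           with _ , ≡.refl ← path-start p =
            y , yx₃ , reverse (y ∷ T) , z , path-reverse N²-sym (inj₁ e ∷ p) , trans (↭-reverse (y ∷ T)) π ,
            e , edge-reverse {l = y ∷ T} fwd
          second : ∃ λ y → E x₃ y × ∃ λ P → Path N² c x₂ P × P ↭ x₃ ∷ c ∷ D × Edge x₃ y P
          second with y , yx₃ , P , e , p , π , ye , h ← slotted
            with P′ , p′ , π′ , h′ ← insert p ye yx₃ h = y , E-sym yx₃ , P′ , p′ , trans π′ (prep x₃ π) , h′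
          combine : First (c ∷ C) x₁ c → (∃ λ y → E x₃ y × ∃ λ P → Path N² c x₂ P × P ↭ x₃ ∷ c ∷ D × Edge x₃ y P) →
                    Strong A x₁ x₂ x₃
          combine (z , T , e , p , π) (y , x₃y , P , q , ρ , h) with m , ≡.refl ← path-start q =
            z , T ++ m , y , e , path-glue p q ,
            trans (++⁺ π (drop-∷ (trans ρ (swap x₃ c refl)))) (trans (prep c (shift x₃ C D))
              (trans (swap c x₃ refl) (↭-sym (trans A↭H (prep x₃ permH))))) , x₃y , edge-glue p h

        -- The edge at `y` is not the first edge of the path, which thus survives the insertion.
        insert-bic : Bic H → ∀ {y} → y ∈ A → E x₃ y → y ≢ x₃ → y ≢ x₁ → y ≢ x₂ → Strong A x₁ x₂ x₃
        insert-bic bicH {y} y∈A x₃y y≢x₃ y≢x₁ y≢x₂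
          with z , T , e , f , p , π , g , h ← IH G shortH (unique-++ʳ [ x₃ ] uH) bicH x₁∈H x₂∈H (inH y∈A y≢x₃)
                 (≢x₁ x₂∈B ∘ ≡.sym) (y≢x₁ ∘ ≡.sym) (y≢x₂ ∘ ≡.sym)
          with T′ , p′ , π′ , h′ ← insert p g (E-sym x₃y) h =
          z , T′ , y , f , p′ , trans (prep x₁ π′) (trans (swap x₁ x₃ refl) (trans (prep x₃ π) (↭-sym A↭H))) , x₃y , h′

      -- The path is going to end in x₃ x₂, so x₂ is no longer a vertex of the sweep but may still be jumped over.
      module Pendant (two : ∀ {y} → y ∈ A → E x₃ y → y ≢ x₃ → y ≡ x₁ ⊎ y ≡ x₂) where

        x₃x₂ : E x₃ x₂
        x₃x₂ with exit {I = _≡ x₃} {T = _≡ x₂} leave ≡.refl (proj₂ bic (inA x₃∈B) (inA x₂∈B) (≢x₁ x₃∈B) (≢x₁ x₂∈B))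
          where
          leave : ∀ {a b} → a ≡ x₃ → b ∈ A ∖ x₁ → E a b → b ≡ x₃ ⊎ b ≡ x₂
          leave {b = b} ≡.refl (i , m) e with b ≟ x₃
          ... | yes p = inj₁ p
          ... | no p with two i e p
          ...   | inj₁ q = ⊥-elim (m q)
          ...   | inj₂ q = inj₂ q
        ... | inj₁ c = ⊥-elim (x₂≢x₃ (proj₂ (conn-target c)))
        ... | inj₂ (_ , _ , c , e , _ , ≡.refl) with ≡.refl ← proj₂ (conn-target c) = e

        x₃x₁ : E x₃ x₁
        x₃x₁ with exit {I = _≡ x₃} {T = _≡ x₁} leave ≡.refl
                    (proj₂ bic (inA x₃∈B) x₁∈A (x₂≢x₃ ∘ ≡.sym) (≢x₁ x₂∈B ∘ ≡.sym))
          where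
          leave : ∀ {a b} → a ≡ x₃ → b ∈ A ∖ x₂ → E a b → b ≡ x₃ ⊎ b ≡ x₁
          leave {b = b} ≡.refl (i , m) e with b ≟ x₃
          ... | yes p = inj₁ p
          ... | no p with two i e p
          ...   | inj₁ q = inj₂ q
          ...   | inj₂ q = ⊥-elim (m q)
        ... | inj₁ c = ⊥-elim (≢x₁ x₃∈B (≡.sym (proj₂ (conn-target c))))
        ... | inj₂ (_ , _ , c , e , _ , ≡.refl) with ≡.refl ← proj₂ (conn-target c) = e

        Y : List V
        Y = x₃ ∷ x₂ ∷ []

        pathY : Path N² x₃ x₂ Y
        pathY = inj₁ x₃x₂ ∷ end x₂

        open Solve (solve Q° linkedQ°)

        rear : ∀ {a p} → At Q° a → E p x₂ → Rear Q° p
        rear = Step.next-Rear x₂ Q° linkedQ (solve Q° linkedQ°)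

        -- A last strand at `x₂` is put in front of `Y` by jumping over `x₂`; an end then still at
        -- `x₂` becomes the rear end.
        unstuck : ∀ {a X F} → Path N² a x₁ X → At Q° a → All (Free Q) F → Linkable x₁ x₂ (conf X Y F Q°)
        unstuck {X = X} p at fs with Locate.resolve x₂ Q° _ ℕ.≤-refl fs
        ... | inj₁ (H , hs , ref) =
          lift-link ref (X ∷ Y ∷ map [_] Q°) (swapXY Q° (rearX pathY (rear at x₃x₂) p at hs))
        ... | inj₂ (s , H , (c , b , q , ec , at-b) , hs , ref) =
          lift-link ref (X ∷ Y ∷ map [_] Q°) (swapXY Q° (joinX-rev Q° (go (Locate.split x₂ Q° at-b))))
          where
          pY = path-++ (path-reverse N²-sym q) (via x₂ ec x₃x₂) pathY
          go : E b x₂ ⊎ At Q° b → Linkable x₂ x₁ (conf (reverse s ++ Y) X H Q°)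
          go (inj₁ e) = rearX pY (rear at e) p at hs
          go (inj₂ i) = none pY i p at hs

        Q°≡[] : w ≡ x₂ → Q° ≡ []
        Q°≡[] p = loop-trivial (unique-++ˡ Q uW) (subst (λ w → Path E x₂ w Q) p pathQ)

        no-free : ∀ {F} → Q° ≡ [] → All (Free Q°) F → F ≡ []
        no-free p [] = ≡.refl
        no-free p ((_ , _ , _ , at , _) ∷ _) with () ← subst (λ Q → At Q _) p at

        w-place : w ≡ x₂ ⊎ (∀ {t} → E w t → At Q° t)
        w-place = go w∈Q
          where
          go : w ∈ Q → w ≡ x₂ ⊎ (∀ {t} → E w t → At Q° t)
          go (here p)  = inj₁ p
          go (there i) = inj₂ λ e → Any.map (λ { ≡.refl → E-sym e }) i

        pair : ∀ {a b X Y′ F} → Q° ≡ [] → All (Free Q°) F → Path N² a x₁ X → N² a b → Path N² b x₂ Y′ →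
               Linkable x₁ x₂ (conf X Y′ F Q°)
        pair {X = X} {Y′} {F} p fs q r q′ =
          ≡.subst₂ (λ F Q → Linkable x₁ x₂ (conf X Y′ F Q)) (≡.sym (no-free p fs)) (≡.sym p) (join-two q r q′)

        -- If `w` is `x₂`, nothing is left to sweep: all strands are at `x₂`, and `X` absorbs them
        -- before meeting `Y` over `x₂`.
        settle : ∀ {t X F} → Path N² t x₁ X → E w t → All (Free Q) F →
                 ∃₂ λ X′ F′ → X ∷ F ⊑ X′ ∷ F′ × Linkable x₁ x₂ (conf X′ Y F′ Q°)
        settle {t} {X} {F} p wt fs with w-place
        ... | inj₂ at = X , F , ⊑-perm refl , unstuck p (at wt) fs
        ... | inj₁ w≡x₂ with Locate.absorb x₂ Q° _ ℕ.≤-refl p (here (subst (E t) w≡x₂ (E-sym wt))) fs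
        ...   | a , X′ , F′ , p′ , ref , inj₁ (e , gs) = X′ , F′ , ref , pair (Q°≡[] w≡x₂) gs p′ (via x₂ e x₃x₂) pathY
        ...   | a , X′ , F′ , p′ , ref , inj₂ (at , gs) with () ← subst (λ Q → At Q a) (Q°≡[] w≡x₂) at

        conf-content : ∀ {X F X′ F′} Y′ → X ∷ F ⊑ X′ ∷ F′ → concat (conf X′ Y′ F′ Q°) ↭ (X ++ concat F) ++ Y′ ++ Q°
        conf-content {X} {F} {X′} {F′} Y′ (π , _) = trans (↭-reflexive (concat-conf X′ Y′ F′ Q°))
          (trans (lemma X′ Y′ Q° (concat F′)) (++⁺ʳ (Y′ ++ Q°) π))
          where
          lemma : ∀ x y q f → x ++ y ++ q ++ f ↭ (x ++ f) ++ y ++ q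
          lemma = ↭-Solver.solve 4
            (λ x y q f → x ⊕ y ⊕ q ⊕ f ⊜ (x ⊕ f) ⊕ y ⊕ q) refl

        in-conf : ∀ {u v X F Y′} → Any (Edge u v) (X ∷ F) → Any (Edge u v) (conf X Y′ F Q°)
        in-conf (here e)  = here e
        in-conf (there a) = in-F Q° a

        finish-up : ∀ {S z} → Linkable x₁ x₂ S → concat S ↭ A → E x₁ z → Any (Edge x₁ z) S →
                    Any (Edge x₃ x₂) S → Strong A x₁ x₂ x₃
        finish-up l σ e i j = assemble uA (≢x₁ x₃∈B) l σ e i x₃x₂ (≢x₁ x₂∈B) j

        closed : ∀ {U′} → U ↭ x₃ ∷ U′ → ∀ {a b} → a ∈ U′ → b ∈ U → E a b → b ∈ U′
        closed {U′} σ {a} {b} i j e with ∈-resp-↭ σ j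
        ... | there k = k
        ... | here ≡.refl with two (inA (U⊆B′ a∈U)) (E-sym e) (λ { ≡.refl → unique-head (unique-↭ σ uU) i })
          where
          a∈U : a ∈ U
          a∈U = ∈-resp-↭ (↭-sym σ) (there i)
        ...   | inj₁ ≡.refl = ⊥-elim (x₁∉U (∈-resp-↭ (↭-sym σ) (there i)))
        ...   | inj₂ ≡.refl = ⊥-elim (unique-disjoint Q uW (here ≡.refl) (∈-resp-↭ (↭-sym σ) (there i)))

        -- The cases are those of `spread`, but the edge at `x₃` is now the last step to `x₂`.
        pendant : Strong A x₁ x₂ x₃
        pendant with U′ , σ ← remove x₃∈U
          with F , π , fs ← partition _ {U′} ℕ.≤-refl (unique-++ʳ [ x₃ ] (unique-↭ σ uU))
                 (ℕ.<-trans (s≤s (ℕ.≤-reflexive (≡.sym (↭-length σ)))) short)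
                 (λ i → x₁∉U (∈-resp-↭ (↭-sym σ) (there i)))
                 (attached (λ i → ∈-resp-↭ (↭-sym σ) (there i)) (closed σ))
          with z , z∈Z , zx₁ ← x₁-neighbour
          with t , T , wt , p , ρ ← strandZ z∈Z
          with l , l∈Z , lw ← exit-at-v petal u₀∈U
          with t′ , T′ , wt′ , p′ , ρ′ ← strandZ (conn-target l∈Z)
          = finish (Locate.resolve x₁ Q _ ℕ.≤-refl fs)
          where
          total : ∀ {T H : List V} → T ↭ Z → H ↭ concat F → x₁ ∷ T ++ Q ++ x₃ ∷ H ↭ A
          total τ χ = regroup τ (trans (prep x₃ (trans χ π)) (↭-sym σ))
          finish : Locate.Resolved x₁ Q F → Strong A x₁ x₂ x₃
          finish (inj₁ (H , hs , ref , sub))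
            with X′ , F′ , r@(_ , keep) , link ← settle (path-++ p (inj₁ zx₁) (end x₁)) wt hs =
            finish-up link (trans (conf-content Y r) (trans (lemma T [ x₁ ] (concat H) [ x₃ ] Q) (total ρ ref)))
              (E-sym zx₁) (in-conf (keep (here (edge-sym (edge-glue p fwd))))) (there (here fwd))
            where
            lemma : ∀ t x h y q → ((t ++ x) ++ h) ++ y ++ q ↭ x ++ t ++ q ++ y ++ h
            lemma = ↭-Solver.solve 5
              (λ t x h y q → ((t ⊕ x) ⊕ h) ⊕ y ⊕ q ⊜ x ⊕ t ⊕ q ⊕ y ⊕ h) refl
          finish (inj₂ (s , H , (a , b , q , ea , at) , hs , ref , sub)) with Locate.split x₁ Q at
          ... | inj₁ eb
            with X′ , F′ , r@(_ , keep) , link ← settle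
                   (path-++ p (via x₁ zx₁ eb) (path-++ (path-reverse N²-sym q) (inj₁ ea) (end x₁))) wt hs =
            finish-up link (trans (conf-content Y r) (trans (lemma T (reverse s) [ x₁ ] (concat H) [ x₃ ] Q)
                (total ρ (trans (++⁺ʳ (concat H) (↭-reverse s)) ref))))
              (E-sym ea) (in-conf (keep (here (edge-++ʳ T (edge-sym (edge-glue (path-reverse N²-sym q) fwd))))))
              (there (here fwd))
            where
            lemma : ∀ t s x h y q → ((t ++ s ++ x) ++ h) ++ y ++ q ↭ x ++ t ++ q ++ y ++ s ++ h
            lemma = ↭-Solver.solve 6
              (λ t s x h y q → ((t ⊕ s ⊕ x) ⊕ h) ⊕ y ⊕ q ⊜ x ⊕ t ⊕ q ⊕ y ⊕ s ⊕ h) refl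
          ... | inj₂ at-b
            with Locate.absorb x₂ Q° _ ℕ.≤-refl (path-++ (path-reverse N²-sym q) (inj₁ ea) (end x₁)) at-b hs
          ...   | a′ , X′ , F′ , p″ , r@(_ , keep) , inj₂ (at′ , gs) =
            finish-up (unstuck p″ at′ ((t′ , l , p′ , atQ wt′ , atQ (E-sym lw)) ∷ gs))
              (trans content (total ρ′ (trans (++⁺ʳ (concat H) (↭-reverse s)) ref)))
              (E-sym ea) (place (keep (here (edge-sym (edge-glue (path-reverse N²-sym q) fwd))))) (there (here fwd))
            where
            place : ∀ {u v} → Any (Edge u v) (X′ ∷ F′) → Any (Edge u v) (conf X′ Y (T′ ∷ F′) Q°)
            place (here e)  = here e
            place (there a) = in-F Q° (there a)
            lemma : ∀ x y q t f → x ++ y ++ q ++ t ++ f ↭ (x ++ f) ++ y ++ q ++ t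
            lemma = ↭-Solver.solve 5
              (λ x y q t f → x ⊕ y ⊕ q ⊕ t ⊕ f ⊜ (x ⊕ f) ⊕ y ⊕ q ⊕ t) refl
            lemma′ : ∀ s x h y q t → ((s ++ x) ++ h) ++ (y ++ q) ++ t ↭ x ++ t ++ q ++ y ++ s ++ h
            lemma′ = ↭-Solver.solve 6
              (λ s x h y q t → ((s ⊕ x) ⊕ h) ⊕ (y ⊕ q) ⊕ t ⊜ x ⊕ t ⊕ q ⊕ y ⊕ s ⊕ h) refl
            content : concat (conf X′ Y (T′ ∷ F′) Q°) ↭ x₁ ∷ T′ ++ Q ++ x₃ ∷ reverse s ++ concat H
            content = trans (↭-reflexive (concat-conf X′ Y (T′ ∷ F′) Q°)) (trans (lemma X′ Y Q° T′ (concat F′))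
              (trans (++⁺ʳ (Y ++ Q° ++ T′) (proj₁ r)) (lemma′ (reverse s) [ x₁ ] (concat H) [ x₃ ] Q T′)))
          -- The open end of `X′` is at `x₂`, so `Z` is put in front of `x₃` by jumping over `x₁`.
          -- Then `X′` is the rear end, or meets `Z` over `x₂` if `w` is `x₂`.
          ...   | a′ , X′ , F′ , p″ , r@(_ , keep) , inj₁ (e , gs) =
            finish-up link (trans (conf-content (T ++ Y) r) (trans (lemma (reverse s) [ x₁ ] (concat H) T [ x₃ ])
                (total ρ (trans (++⁺ʳ (concat H) (↭-reverse s)) ref))))
              (E-sym ea) (in-conf (keep (here (edge-sym (edge-glue (path-reverse N²-sym q) fwd)))))
              (there (here (edge-++ʳ T fwd)))
            where
            pY : Path N² t x₂ (T ++ Y)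
            pY = path-++ p (via x₁ zx₁ x₃x₁) pathY
            link : Linkable x₁ x₂ (conf X′ (T ++ Y) F′ Q°)
            link with w-place
            ... | inj₂ at = rearX p″ (rear (at wt) e) pY (at wt) gs
            ... | inj₁ w≡x₂ = pair (Q°≡[] w≡x₂) gs p″ (via x₂ e (subst (E t) w≡x₂ (E-sym wt))) pY
            lemma : ∀ s x h t y → ((s ++ x) ++ h) ++ (t ++ y ++ [ x₂ ]) ++ Q° ↭ x ++ t ++ Q ++ y ++ s ++ h
            lemma s x h t y = ↭-Solver.solve 7
              (λ s x h t y z q → ((s ⊕ x) ⊕ h) ⊕ (t ⊕ y ⊕ z) ⊕ q ⊜ x ⊕ t ⊕ (z ⊕ q) ⊕ y ⊕ s ⊕ h) refl s x h t y [ x₂ ] Q°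

      sweep : Strong A x₁ x₂ x₃
      sweep = go (Any.any? (λ y → E? x₃ y ×-dec ¬? (y ∈? Q) ×-dec ¬? (y ≟ x₁) ×-dec ¬? (y ≟ x₃)) A)
        where
        go : Dec (Any (λ y → E x₃ y × y ∉ Q × y ≢ x₁ × y ≢ x₃) A) → Strong A x₁ x₂ x₃
        go (yes a) with y , A′ , (e , y∉Q , y≢x₁ , y≢x₃) , σ ← pick a
          with ∈-++⁻ Z (∈-∷⁻ (∈-resp-↭ A↭Q (∈-resp-↭ (↭-sym σ) (here ≡.refl))) y≢x₁)
        ... | inj₁ y∈Z = ⊥-elim (ZU y∈Z x₃∈U (E-sym e))
        ... | inj₂ i with ∈-++⁻ Q i
        ...   | inj₁ y∈Q = ⊥-elim (y∉Q y∈Q)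
        ...   | inj₂ y∈U = spread y∈U y≢x₃ e
        go (no ∄) with H , σ ← remove (inA x₃∈B) = split σ (bic-or-cut _≟_ E? (unique-++ʳ [ x₃ ] (unique-↭ σ uA)) (Tight.stH tight σ))
          where
          tight : ∀ {y} → y ∈ A → E x₃ y → y ≢ x₃ → y ∈ Q ⊎ y ≡ x₁
          tight {y} i e n with y ∈? Q | y ≟ x₁
          ... | yes j | _ = inj₁ j
          ... | no _ | yes q = inj₂ q
          ... | no j | no q = ⊥-elim (∄ (Any.map (λ { ≡.refl → e , j , q , n }) i))
          split : ∀ {H} → A ↭ x₃ ∷ H → Bic H ⊎ Cut H x₁ x₂ → Strong A x₁ x₂ x₃
          split σ (inj₂ cut) = Tight.insert-cut tight σ cut
          split σ (inj₁ bicH)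
            with Any.any? (λ y → E? x₃ y ×-dec ¬? (y ≟ x₃) ×-dec ¬? (y ≟ x₁) ×-dec ¬? (y ≟ x₂)) A
          ... | yes a with y , A′ , (e , n₃ , n₁ , n₂) , τ ← pick a =
            Tight.insert-bic tight σ bicH (∈-resp-↭ (↭-sym τ) (here ≡.refl)) e n₃ n₁ n₂
          ... | no ∄′ = Pendant.pendant two
            where
            two : ∀ {y} → y ∈ A → E x₃ y → y ≢ x₃ → y ≡ x₁ ⊎ y ≡ x₂
            two {y} i e n with y ≟ x₁ | y ≟ x₂
            ... | yes q | _ = inj₁ q
            ... | no _ | yes q = inj₂ q
            ... | no p | no q = ⊥-elim (∄′ (Any.map (λ { ≡.refl → e , n , p , q }) i))

    from-leaf : Strong A x₁ x₂ x₃
    from-leaf with simple outer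
    ... | l , p , u , inside with path-start p
    ...   | Q° , ≡.refl = WithPath.sweep p (proj₂ (extract u (All.map proj₁ inside)))
                            (λ i → proj₂ (All.lookup inside i) ≡.refl)

-- The induction and the transfer to graphs.

strong : ∀ {V : Set} → DecidableEquality V → ∀ n → Hyp V n
strong _≟_ (suc n) G (s≤s A≤n) u bic i j k x₁≢x₂ x₁≢x₃ x₂≢x₃ with B , σ ← remove i
  with j′ ← ∈-∷⁻ (∈-resp-↭ σ j) (x₁≢x₂ ∘ ≡.sym)
  with k′ ← ∈-∷⁻ (∈-resp-↭ σ k) (x₁≢x₃ ∘ ≡.sym)
  with Petals.Around.leaf-or-done _≟_ (strong _≟_ n) G A≤n u bic σ j′ k′ x₂≢x₃
... | inj₁ leaf = WithLeaf.from-leaf _≟_ (strong _≟_ n) G A≤n u bic σ j′ k′ x₂≢x₃ leaf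
... | inj₂ done = done

edge→PathEdge : ∀ {V : Set} {u v : V} {l} → Edge u v l → PathEdge l u v
edge→PathEdge fwd = inj₁ ([] , _ , ≡.refl)
edge→PathEdge bwd = inj₂ ([] , _ , ≡.refl)
edge→PathEdge (next {x} e) with edge→PathEdge e
... | inj₁ (as , bs , p) = inj₁ (x ∷ as , bs , cong (x ∷_) p)
... | inj₂ (as , bs , p) = inj₂ (x ∷ as , bs , cong (x ∷_) p)

-- Adjacency need not be decidable; the finitely many edges on the walks witnessing 2-connectedness are enough.
module Witnesses {n : ℕ} (G : Graph n) (tc : TwoConnected G) where

  V : Set
  V = Fin n

  edges : ∀ {P : V → Set} {u w} → ConnIn G P u w → List (V × V)
  edges (here _)               = []
  edges (step {u} {v} _ _ c) = (u , v) ∷ edges c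

  edges-adj : ∀ {P : V → Set} {u w} (c : ConnIn G P u w) → All (λ e → Adj G (proj₁ e) (proj₂ e)) (edges c)
  edges-adj (here _)     = []
  edges-adj (step _ a c) = a ∷ edges-adj c

  plain : List (V × V)
  plain = concatMap (λ u → concatMap (λ w → edges (proj₁ (proj₂ tc) u w)) (allFin n)) (allFin n)

  avoiding : V → V → V → List (V × V)
  avoiding v u w with u Fin.≟ v | w Fin.≟ v
  ... | no m | no m′ = edges (proj₂ (proj₂ tc) v u w m m′)
  -- If an end is the deleted vertex, there is no walk to record.
  ... | _    | _     = []

  support : List (V × V)
  support = plain ++ concatMap (λ v → concatMap (λ u → concatMap (avoiding v u) (allFin n)) (allFin n)) (allFin n)

  concatMap-all : ∀ {X : Set} {P : V × V → Set} (f : X → List (V × V)) L → (∀ x → All P (f x)) → All P (concatMap f L)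
  concatMap-all f L h = All.concat⁺ (All.map⁺ (All.universal h L))

  support-adj : All (λ e → Adj G (proj₁ e) (proj₂ e)) support
  support-adj = All.++⁺
    (concatMap-all _ (allFin n) λ u → concatMap-all _ (allFin n) λ w → edges-adj (proj₁ (proj₂ tc) u w))
    (concatMap-all _ (allFin n) λ v → concatMap-all _ (allFin n) λ u → concatMap-all _ (allFin n) λ w → avoiding-adj v u w)
    where
    avoiding-adj : ∀ v u w → All (λ e → Adj G (proj₁ e) (proj₂ e)) (avoiding v u w)
    avoiding-adj v u w with u Fin.≟ v | w Fin.≟ v
    ... | no m  | no m′ = edges-adj (proj₂ (proj₂ tc) v u w m m′)
    ... | no _  | yes _ = []
    ... | yes _ | _     = []

  E : V → V → Set
  E u v = (u , v) ∈ support ⊎ (v , u) ∈ support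

  E? : Decidable E
  E? u v = ((u , v) ∈? support) ⊎-dec ((v , u) ∈? support)
    where
    open import Data.List.Membership.DecPropositional (≡-dec Fin._≟_ Fin._≟_) using (_∈?_)
    open import Relation.Nullary.Decidable using (_⊎-dec_)

  H : Rel V
  H = record { E = E ; E? = E? ; E-sym = λ { (inj₁ i) → inj₂ i ; (inj₂ i) → inj₁ i } }

  open Notions H hiding (E; E?) public

  E⇒Adj : ∀ {u v} → E u v → Adj G u v
  E⇒Adj (inj₁ i) = All.lookup support-adj i
  E⇒Adj (inj₂ i) = sym G (All.lookup support-adj i)

  convert : ∀ {P : V → Set} {u w} (c : ConnIn G P u w) → (∀ {e} → e ∈ edges c → e ∈ support) → Conn P u w
  convert (here p)     f = stop p
  convert (step p _ c) f = step p (inj₁ (f (here ≡.refl))) (convert c (f ∘ there))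

  ∈-concatMap : ∀ {f : V → List (V × V)} x {e} → e ∈ f x → e ∈ concatMap f (allFin n)
  ∈-concatMap x i = Any.concatMap⁺ _ (lose (∈-allFin x) i)

  -- The inequalities are decided anew, so that the walk is the very one whose edges were recorded.
  avoiding-conn : ∀ {v u w} → u ≢ v → w ≢ v → Σ (ConnIn G (_≢ v) u w) λ c → ∀ {e} → e ∈ edges c → e ∈ avoiding v u w
  avoiding-conn {v} {u} {w} m m′ with u Fin.≟ v | w Fin.≟ v
  ... | yes p | _     = ⊥-elim (m p)
  ... | no _  | yes p = ⊥-elim (m′ p)
  ... | no p  | no p′ = proj₂ (proj₂ tc) v u w p p′ , id

  bicH : Bic (allFin n)
  bicH = (λ {u} {w} _ _ → conn-map (λ _ → ∈-allFin _) (convert (proj₁ (proj₂ tc) u w)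
            (λ i → ∈-++⁺ˡ (∈-concatMap u (∈-concatMap w i))))) ,
         (λ {v} {u} {w} _ _ m m′ → conn-map (λ q → ∈-allFin _ , q) (convert (proj₁ (avoiding-conn m m′))
            (λ i → ∈-++⁺ʳ plain (∈-concatMap v (∈-concatMap u (∈-concatMap w (proj₂ (avoiding-conn m m′) i)))))))

  hamPath : ∀ {x y P} → Path N² x y P → P ↭ allFin n → HamPath (Sq G) x y P
  hamPath p π = u , (λ v → ∈-resp-↭ (↭-sym π) (∈-allFin v)) , linked p u , first p , final p
    where
    u = unique-↭ (↭-sym π) (allFin⁺ n)
    adj : ∀ {a b} → N² a b → Adj G a b ⊎ ∃ λ m → Adj G a m × Adj G m b
    adj (inj₁ e)           = inj₁ (E⇒Adj e)
    adj (inj₂ (m , e , f)) = inj₂ (m , E⇒Adj e , E⇒Adj f)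
    linked : ∀ {x y P} → Path N² x y P → Unique P → Linked (Adj (Sq G)) P
    linked (end _) _ = [-]
    linked (r ∷ end _) ((n ∷ _) ∷ _) = (n , adj r) ∷ [-]
    linked (r ∷ p@(_ ∷ _)) ((n ∷ _) ∷ u) = (n , adj r) ∷ linked p u
    first : ∀ {x y P} → Path N² x y P → head P ≡ just x
    first (end _) = ≡.refl
    first (_ ∷ _) = ≡.refl
    final : ∀ {x y P} → Path N² x y P → last P ≡ just y
    final (end _) = ≡.refl
    final (_ ∷ end _) = ≡.refl
    final (_ ∷ p@(_ ∷ _)) = final p

  strongH : ∀ {x y w} → x ≢ y → x ≢ w → y ≢ w → Strong (allFin n) x y w
  strongH = strong Fin._≟_ _ H (ℕ.≤-refl) (allFin⁺ n) bicH (∈-allFin _) (∈-allFin _) (∈-allFin _)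

  -- `x` is neither `w` nor a vertex of the tail `T`, in which the edge at `w` lies.
  distinct : ∀ {x z w e T} → x ∷ T ↭ allFin n → w ≢ x → Edge w e T → ¬ SameEdge w e x z
  distinct π w≢x i (inj₁ (p , _)) = w≢x p
  distinct π w≢x i (inj₂ (_ , ≡.refl)) = unique-head (unique-↭ (↭-sym π) (allFin⁺ n)) (edge-target i)

  Answer : V → V → V → V → Set
  Answer x y w xᵢ = Σ (List V) λ p → HamPath (Sq G) x y p
    × ∃₂ λ z₃ zᵢ → Adj G w z₃ × Adj G xᵢ zᵢ
    × PathEdge p w z₃ × PathEdge p xᵢ zᵢ × ¬ SameEdge w z₃ xᵢ zᵢ

  from-first : ∀ {x y w} → w ≢ x → Strong (allFin n) x y w → Answer x y w x
  from-first {x} m (z , T , e , xz , p , π , we , i) with _ , ≡.refl ← path-start p =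
    x ∷ T , hamPath (inj₁ xz ∷ p) π , e , z , E⇒Adj we , E⇒Adj xz ,
    edge→PathEdge (next i) , edge→PathEdge fwd , distinct π m i

  -- The path is constructed from `y` to `x` and reversed, so that the edge at its start becomes the
  -- one at its end.
  from-last : ∀ {x y w} → w ≢ y → Strong (allFin n) y x w → Answer x y w y
  from-last {y = y} m (z , T , e , yz , p , π , we , i) with _ , ≡.refl ← path-start p =
    reverse (y ∷ T) , hamPath (path-reverse N²-sym (inj₁ yz ∷ p)) (trans (↭-reverse (y ∷ T)) π) ,
    e , z , E⇒Adj we , E⇒Adj yz ,
    edge→PathEdge (edge-reverse (next {x = y} i)) , edge→PathEdge (edge-reverse {l = y ∷ T} fwd) , distinct π m i

theorem3 : ∀ {n} (G : Graph n) → TwoConnected G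
    → (x₁ x₂ x₃ : Fin n) → x₁ ≢ x₂ → x₁ ≢ x₃ → x₂ ≢ x₃
    → (xᵢ : Fin n) → (xᵢ ≡ x₁ ⊎ xᵢ ≡ x₂)
    → Σ (List (Fin n)) λ p → HamPath (Sq G) x₁ x₂ p
    × ∃₂ λ z₃ zᵢ → Adj G x₃ z₃ × Adj G xᵢ zᵢ
    × PathEdge p x₃ z₃ × PathEdge p xᵢ zᵢ × ¬ SameEdge x₃ z₃ xᵢ zᵢ
theorem3 G tc x₁ x₂ x₃ m₁₂ m₁₃ m₂₃ xᵢ (inj₁ ≡.refl) =
  Witnesses.from-first G tc (m₁₃ ∘ ≡.sym) (Witnesses.strongH G tc m₁₂ m₁₃ m₂₃)
theorem3 G tc x₁ x₂ x₃ m₁₂ m₁₃ m₂₃ xᵢ (inj₂ ≡.refl) =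
  Witnesses.from-last G tc (m₂₃ ∘ ≡.sym) (Witnesses.strongH G tc (m₁₂ ∘ ≡.sym) m₂₃ m₁₃)
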